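{- For every real number $\beta>1$ there is an (explicitly constructed) series whose sum $\tau_\beta$ is an irrational number with irrationality base $\beta(\tau_\beta)=\beta$ and which is not approximable to order $\beta^{ -x}$; in fact, $$\left|\tau_\beta-\frac pq\right|>\frac{1}{\beta^q}\quad\text{for all integers }p,q\text{, with }q>0\text{ sufficiently large.}$$ If $\beta=b/a>1$ is a rational number in lowest terms, with $b>0$, then one such number is $$\tau_\beta=\beta^{ -1}+\beta^{ -b}+\beta^{ -b^b}+\cdots=\sum_{n=0}^{\infty}\beta^{ -t_n},\qquad t_0=1,\quad t_{n+1}=b^{t_n}\ (n\ge0).$$
   Context: Irrationality base: for a real irrational number $\alpha$, $\beta(\alpha)$ is the least real $\beta\ge 1$ such that for every $\varepsilon>0$ there is a positive integer $q(\varepsilon)$ with $\left|\alpha-\frac pq\right|>\frac{1}{(\beta+\varepsilon)^q}$ for all integers $p,q$ with $q\ge q(\varepsilon)$; if no such $\beta$ exists, $\beta(\alpha)=\infty$. Given a real number $\theta$ and a positive real-valued function $\omega(x)$ defined for $x\ge1$, $\theta$ is approximable to order $\omega$ if for every $C>0$ there exists a pair of integers $p,q$, with $q>C$, such that $\left|\theta-\frac pq\right|<\omega(q)$. "For all integers $p,q$, with $q>0$ sufficiently large" means: there is $q_0$ (depending on $\tau_\beta$) such that the inequality holds for all integers $p,q$ with $q\ge q_0$. -}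

module Defs where

open import Data.Nat.Base as ℕ using (ℕ; zero; suc; NonZero)
import Data.Nat.Properties as ℕₚ
open import Data.Integer.Base using (ℤ; +_)
open import Data.Rational.Base hiding (NonZero)
open import Data.Rational.Properties
open import Data.Rational.Solver using (module +-*-Solver)
open import Data.Product.Base using (_×_; _,_; ∃-syntax; Σ-syntax)
open import Data.Sum.Base using (inj₁; inj₂)
open import Relation.Binary.PropositionalEquality
  using (_≡_; refl; sym; trans; cong; cong₂; subst; subst₂)
open import Relation.Nullary using (¬_; yes; no; contradiction)

open +-*-Solver using (solve; _:=_; _:+_; _:*_; _:-_; :-_)

0<1ℚ : 0ℚ < 1ℚ
0<1ℚ = positive⁻¹ 1ℚ

0<½* : ∀ {ε} → 0ℚ < ε → 0ℚ < ½ * ε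
0<½* {ε} p = subst (_< ½ * ε) (*-zeroʳ ½) (*-monoʳ-<-pos ½ p)

½*+½*≡ : ∀ ε → ½ * ε + ½ * ε ≡ ε
½*+½*≡ ε = trans (sym (*-distribʳ-+ ε ½ ½)) (*-identityˡ ε)

0<* : ∀ {p q} → 0ℚ < p → 0ℚ < q → 0ℚ < p * q
0<* {p} {q} 0<p 0<q =
  subst (_< p * q) (*-zeroʳ p) (*-monoʳ-<-pos p {{positive 0<p}} 0<q)

*-mono-< : ∀ {p q r s} → 0ℚ < p → 0ℚ < s → p < q → r < s → p * r < q * s
*-mono-< {p} {s = s} 0<p 0<s p<q r<s = <-trans
  (*-monoʳ-<-pos p {{positive 0<p}} r<s)
  (*-monoˡ-<-pos s {{positive 0<s}} p<q)

∣p∣*∣q∣<b*c : ∀ {p q b c} → 0ℚ < b → ∣ p ∣ ≤ b → ∣ q ∣ < c →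
              ∣ p ∣ * ∣ q ∣ < b * c
∣p∣*∣q∣<b*c {p} {q} {b} 0<b ∣p∣≤b ∣q∣<c = ≤-<-trans
  (*-monoʳ-≤-nonNeg ∣ q ∣ {{∣-∣-nonNeg q}} ∣p∣≤b)
  (*-monoʳ-<-pos b {{positive 0<b}} ∣q∣<c)

∣p-q∣≡∣q-p∣ : ∀ p q → ∣ p - q ∣ ≡ ∣ q - p ∣
∣p-q∣≡∣q-p∣ p q = trans (sym (∣-p∣≡∣p∣ (p - q)))
  (cong ∣_∣ (solve 2 (λ p q → :- (p :- q) := q :- p) refl p q))

p≤∣p∣ : ∀ p → p ≤ ∣ p ∣
p≤∣p∣ p with ≤-total 0ℚ p
... | inj₁ 0≤p = ≤-reflexive (sym (0≤p⇒∣p∣≡p 0≤p))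
... | inj₂ p≤0 = ≤-trans p≤0 (0≤∣p∣ p)

p≤∣p-q∣+q : ∀ p q → p ≤ ∣ p - q ∣ + q
p≤∣p-q∣+q p q = subst (_≤ ∣ p - q ∣ + q)
  (solve 2 (λ p q → (p :- q) :+ q := p) refl p q)
  (+-monoˡ-≤ q (p≤∣p∣ (p - q)))

∣p∣-∣q∣≤∣p-q∣ : ∀ p q → ∣ p ∣ - ∣ q ∣ ≤ ∣ p - q ∣
∣p∣-∣q∣≤∣p-q∣ p q = subst (∣ p ∣ - ∣ q ∣ ≤_)
  (solve 2 (λ a b → (a :+ b) :- b := a) refl ∣ p - q ∣ ∣ q ∣)
  (+-monoˡ-≤ (- ∣ q ∣)
    (subst (λ r → ∣ r ∣ ≤ ∣ p - q ∣ + ∣ q ∣)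
      (solve 2 (λ p q → (p :- q) :+ q := p) refl p q)
      (∣p+q∣≤∣p∣+∣q∣ (p - q) q)))

∣∣p∣-∣q∣∣≤∣p-q∣ : ∀ p q → ∣ ∣ p ∣ - ∣ q ∣ ∣ ≤ ∣ p - q ∣
∣∣p∣-∣q∣∣≤∣p-q∣ p q with ∣p∣≡p∨∣p∣≡-p (∣ p ∣ - ∣ q ∣)
... | inj₁ e = subst (_≤ ∣ p - q ∣) (sym e) (∣p∣-∣q∣≤∣p-q∣ p q)
... | inj₂ e = subst₂ _≤_
  (sym (trans e (solve 2 (λ a b → :- (a :- b) := b :- a) refl ∣ p ∣ ∣ q ∣)))
  (∣p-q∣≡∣q-p∣ q p)
  (∣p∣-∣q∣≤∣p-q∣ q p)

-- The reciprocal, totalised by inv 0 = 0.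
inv : ℚ → ℚ
inv p with p ≟ 0ℚ
... | yes _   = 0ℚ
... | no p≢0 = (1/ p) {{≢-nonZero p≢0}}

*-inv : ∀ {p} → 0ℚ < p → p * inv p ≡ 1ℚ
*-inv {p} 0<p with p ≟ 0ℚ
... | yes p≡0 = contradiction (subst (0ℚ <_) p≡0 0<p) (<-irrefl refl)
... | no p≢0 = *-inverseʳ p {{≢-nonZero p≢0}}

0<inv : ∀ {p} → 0ℚ < p → 0ℚ < inv p
0<inv {p} 0<p = *-cancelˡ-<-nonNeg p {{nonNegative (<⇒≤ 0<p)}}
  (subst₂ _<_ (sym (*-zeroʳ p)) (sym (*-inv 0<p)) 0<1ℚ)

inv-antimono-< : ∀ {p q} → 0ℚ < p → p < q → inv q < inv p
inv-antimono-< {p} {q} 0<p p<q =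
  *-cancelˡ-<-nonNeg p {{nonNegative (<⇒≤ 0<p)}}
    (subst (p * inv q <_) (trans (*-inv 0<q) (sym (*-inv 0<p)))
      (*-monoˡ-<-pos (inv q) {{positive (0<inv 0<q)}} p<q))
  where 0<q = <-trans 0<p p<q

inv-inv : ∀ {p q} → 0ℚ < p → 0ℚ < q → inv p - inv q ≡ (inv p * inv q) * (q - p)
inv-inv {p} {q} 0<p 0<q = sym (trans
  (solve 4 (λ p q i j → (i :* j) :* (q :- p) := i :* (q :* j) :- j :* (p :* i))
    refl p q (inv p) (inv q))
  (cong₂ _-_
    (trans (cong (inv p *_) (*-inv 0<q)) (*-identityʳ (inv p)))
    (trans (cong (inv q *_) (*-inv 0<p)) (*-identityʳ (inv q)))))

-- Real numbers are Cauchy sequences of rationals, with ℝ a setoid under _≃ᴿ_.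
-- Since Eventually and Cauchy carry their witnesses, every sequence comes with
-- a modulus of convergence.

Eventually : (ℕ → Set) → Set
Eventually P = ∃[ N ] (∀ n → N ℕ.≤ n → P n)

Cauchy : (ℕ → ℚ) → Set
Cauchy s = ∀ ε → 0ℚ < ε →
  ∃[ N ] (∀ m n → N ℕ.≤ m → N ℕ.≤ n → ∣ s m - s n ∣ < ε)

record ℝ : Set where
  constructor mkℝ
  field
    seq    : ℕ → ℚ
    cauchy : Cauchy seq

open ℝ public

infix 4 _≃ᴿ_ _<ᴿ_ _≤ᴿ_

_≃ᴿ_ : ℝ → ℝ → Set
x ≃ᴿ y = ∀ ε → 0ℚ < ε → Eventually λ n → ∣ seq x n - seq y n ∣ < ε

_<ᴿ_ : ℝ → ℝ → Set
x <ᴿ y = ∃[ ε ] (0ℚ < ε × Eventually λ n → seq x n + ε < seq y n)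

_≤ᴿ_ : ℝ → ℝ → Set
x ≤ᴿ y = ¬ (y <ᴿ x)

fromℚ : ℚ → ℝ
fromℚ p = mkℝ (λ _ → p) λ ε 0<ε →
  0 , λ _ _ _ _ → subst (λ r → ∣ r ∣ < ε) (sym (+-inverseʳ p)) 0<ε

0ᴿ 1ᴿ : ℝ
0ᴿ = fromℚ 0ℚ
1ᴿ = fromℚ 1ℚ

infixl 6 _+ᴿ_ _-ᴿ_
infixl 7 _*ᴿ_
infix  8 -ᴿ_
infixr 8 _^ᴿ_

_+ᴿ_ : ℝ → ℝ → ℝ
x +ᴿ y = mkℝ (λ n → seq x n + seq y n) λ ε 0<ε →
  let (M , f) = cauchy x (½ * ε) (0<½* 0<ε)
      (N , g) = cauchy y (½ * ε) (0<½* 0<ε)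
  in M ℕ.⊔ N , λ m n m≥ n≥ →
    subst (λ r → ∣ r ∣ < ε)
      (solve 4 (λ a b c d → (a :- b) :+ (c :- d) := (a :+ c) :- (b :+ d)) refl
        (seq x m) (seq x n) (seq y m) (seq y n))
      (≤-<-trans (∣p+q∣≤∣p∣+∣q∣ (seq x m - seq x n) (seq y m - seq y n))
        (subst (∣ seq x m - seq x n ∣ + ∣ seq y m - seq y n ∣ <_) (½*+½*≡ ε)
          (+-mono-<
            (f m n (ℕₚ.m⊔n≤o⇒m≤o M N m≥) (ℕₚ.m⊔n≤o⇒m≤o M N n≥))
            (g m n (ℕₚ.m⊔n≤o⇒n≤o M N m≥) (ℕₚ.m⊔n≤o⇒n≤o M N n≥)))))

-ᴿ_ : ℝ → ℝ
-ᴿ x = mkℝ (λ n → - seq x n) λ ε 0<ε →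
  let (N , f) = cauchy x ε 0<ε
  in N , λ m n m≥ n≥ →
    subst (_< ε)
      (trans (sym (∣-p∣≡∣p∣ (seq x m - seq x n)))
        (cong ∣_∣ (solve 2 (λ a b → :- (a :- b) := (:- a) :- (:- b)) refl
          (seq x m) (seq x n))))
      (f m n m≥ n≥)

_-ᴿ_ : ℝ → ℝ → ℝ
x -ᴿ y = x +ᴿ (-ᴿ y)

∣_∣ᴿ : ℝ → ℝ
∣ x ∣ᴿ = mkℝ (λ n → ∣ seq x n ∣) λ ε 0<ε →
  let (N , f) = cauchy x ε 0<ε
  in N , λ m n m≥ n≥ →
    ≤-<-trans (∣∣p∣-∣q∣∣≤∣p-q∣ (seq x m) (seq x n)) (f m n m≥ n≥)

bounded : ∀ x → ∃[ B ] (0ℚ < B × Eventually λ n → ∣ seq x n ∣ ≤ B)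
bounded x =
  let (N , f) = cauchy x 1ℚ 0<1ℚ
      c = seq x N
  in 1ℚ + ∣ c ∣
   , <-≤-trans 0<1ℚ (subst (_≤ 1ℚ + ∣ c ∣) (+-identityʳ 1ℚ)
       (+-monoʳ-≤ 1ℚ (0≤∣p∣ c)))
   , N , λ n n≥ → ≤-trans
       (subst (λ r → ∣ r ∣ ≤ ∣ seq x n - c ∣ + ∣ c ∣)
         (solve 2 (λ p q → (p :- q) :+ q := p) refl (seq x n) c)
         (∣p+q∣≤∣p∣+∣q∣ (seq x n - c) c))
       (+-monoˡ-≤ ∣ c ∣ (<⇒≤ (f n N n≥ ℕₚ.≤-refl)))

_*ᴿ_ : ℝ → ℝ → ℝ
x *ᴿ y = mkℝ (λ n → seq x n * seq y n) λ ε 0<ε →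
  let (A , 0<A , K , a) = bounded x
      (B , 0<B , L , b) = bounded y
      0<A+B = +-mono-< 0<A 0<B
      δ = inv (A + B) * ε
      0<δ = 0<* (0<inv 0<A+B) 0<ε
      (M , f) = cauchy x δ 0<δ
      (N , g) = cauchy y δ 0<δ
      N₀ = (K ℕ.⊔ L) ℕ.⊔ (M ℕ.⊔ N)
      KL = λ {k} (k≥ : N₀ ℕ.≤ k) → ℕₚ.m⊔n≤o⇒m≤o (K ℕ.⊔ L) (M ℕ.⊔ N) k≥
      MN = λ {k} (k≥ : N₀ ℕ.≤ k) → ℕₚ.m⊔n≤o⇒n≤o (K ℕ.⊔ L) (M ℕ.⊔ N) k≥
      total : A * δ + B * δ ≡ ε
      total = trans
        (solve 4 (λ A B i ε → A :* (i :* ε) :+ B :* (i :* ε)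
                            := ((A :+ B) :* i) :* ε)
          refl A B (inv (A + B)) ε)
        (trans (cong (_* ε) (*-inv 0<A+B)) (*-identityˡ ε))
  in N₀ , λ m n m≥ n≥ →
    let p = seq x m ; q = seq x n ; r = seq y m ; s = seq y n in
    subst (λ z → ∣ z ∣ < ε)
      (solve 4 (λ p q r s → p :* (r :- s) :+ s :* (p :- q)
                          := p :* r :- q :* s) refl p q r s)
      (≤-<-trans (∣p+q∣≤∣p∣+∣q∣ (p * (r - s)) (s * (p - q)))
        (subst₂ _<_
          (sym (cong₂ _+_ (∣p*q∣≡∣p∣*∣q∣ p (r - s)) (∣p*q∣≡∣p∣*∣q∣ s (p - q))))
          total
          (+-mono-<
            (∣p∣*∣q∣<b*c {p} {r - s} 0<A
              (a m (ℕₚ.m⊔n≤o⇒m≤o K L (KL m≥)))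
              (g m n (ℕₚ.m⊔n≤o⇒n≤o M N (MN m≥)) (ℕₚ.m⊔n≤o⇒n≤o M N (MN n≥))))
            (∣p∣*∣q∣<b*c {s} {p - q} 0<B
              (b n (ℕₚ.m⊔n≤o⇒n≤o K L (KL n≥)))
              (f m n (ℕₚ.m⊔n≤o⇒m≤o M N (MN m≥)) (ℕₚ.m⊔n≤o⇒m≤o M N (MN n≥)))))))

_^ᴿ_ : ℝ → ℕ → ℝ
x ^ᴿ zero  = 1ᴿ
x ^ᴿ suc n = x *ᴿ (x ^ᴿ n)

0<ᴿ⇒away : ∀ {x} → 0ᴿ <ᴿ x → ∃[ ε ] (0ℚ < ε × Eventually λ n → ε < seq x n)
0<ᴿ⇒away {x} (ε , 0<ε , N , f) =
  ε , 0<ε , N , λ n n≥ → subst (_< seq x n) (+-identityˡ ε) (f n n≥)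

away⇒0<ᴿ : ∀ {x} ε → 0ℚ < ε → Eventually (λ n → ε < seq x n) → 0ᴿ <ᴿ x
away⇒0<ᴿ {x} ε 0<ε (N , f) =
  ε , 0<ε , N , λ n n≥ → subst (_< seq x n) (sym (+-identityˡ ε)) (f n n≥)

-- A real reciprocal needs a positive rational lower bound, so it takes a
-- positivity proof; the underlying sequence does not depend on that proof.
recip : (x : ℝ) → 0ᴿ <ᴿ x → ℝ
recip x 0<x = mkℝ (λ n → inv (seq x n)) λ ε 0<ε →
  let (c , 0<c , M , a) = 0<ᴿ⇒away {x} 0<x
      0<i = 0<inv 0<c
      0<c²ε = 0<* (0<* 0<c 0<c) 0<ε
      (N , f) = cauchy x ((c * c) * ε) 0<c²ε
      i²c²ε≡ε : (inv c * inv c) * ((c * c) * ε) ≡ ε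
      i²c²ε≡ε = trans
        (solve 3 (λ c i ε → (i :* i) :* ((c :* c) :* ε)
                         := (c :* i) :* ((c :* i) :* ε)) refl c (inv c) ε)
        (trans (cong (λ z → z * (z * ε)) (*-inv 0<c))
          (trans (*-identityˡ _) (*-identityˡ ε)))
  in M ℕ.⊔ N , λ m n m≥ n≥ →
    let p = seq x m ; q = seq x n
        c<p = a m (ℕₚ.m⊔n≤o⇒m≤o M N m≥)
        c<q = a n (ℕₚ.m⊔n≤o⇒m≤o M N n≥)
        0<p = <-trans 0<c c<p
        0<q = <-trans 0<c c<q
        0<ij = 0<* (0<inv 0<p) (0<inv 0<q)
        ij≤i² = <⇒≤ (*-mono-< (0<inv 0<p) 0<i
                  (inv-antimono-< 0<c c<p) (inv-antimono-< 0<c c<q))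
    in subst₂ _<_
      (trans (sym (∣p*q∣≡∣p∣*∣q∣ (inv p * inv q) (q - p)))
        (cong ∣_∣ (sym (inv-inv 0<p 0<q))))
      i²c²ε≡ε
      (∣p∣*∣q∣<b*c {inv p * inv q} {q - p} (0<* 0<i 0<i)
        (subst (_≤ inv c * inv c) (sym (0≤p⇒∣p∣≡p (<⇒≤ 0<ij))) ij≤i²)
        (f n m (ℕₚ.m⊔n≤o⇒n≤o M N n≥) (ℕₚ.m⊔n≤o⇒n≤o M N m≥)))

0<x^n : ∀ {x} → 0ᴿ <ᴿ x → ∀ n → 0ᴿ <ᴿ x ^ᴿ n
0<x^n {x} 0<x zero    = away⇒0<ᴿ {1ᴿ} ½ (positive⁻¹ ½)
  (0 , λ _ _ → subst₂ _<_ (+-identityʳ ½) (½*+½*≡ 1ℚ) (+-monoʳ-< ½ (positive⁻¹ ½)))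
0<x^n {x} 0<x (suc n) =
  let (c , 0<c , M , f) = 0<ᴿ⇒away {x} 0<x
      (d , 0<d , N , g) = 0<ᴿ⇒away {x ^ᴿ n} (0<x^n {x} 0<x n)
  in away⇒0<ᴿ {x ^ᴿ suc n} (c * d) (0<* 0<c 0<d)
    (M ℕ.⊔ N , λ k k≥ →
      let d<y = g k (ℕₚ.m⊔n≤o⇒n≤o M N k≥)
      in *-mono-< 0<c (<-trans 0<d d<y) (f k (ℕₚ.m⊔n≤o⇒m≤o M N k≥)) d<y)

1/_^_⟨_⟩ : (x : ℝ) → ℕ → 0ᴿ <ᴿ x → ℝ
1/ x ^ n ⟨ 0<x ⟩ = recip (x ^ᴿ n) (0<x^n {x} 0<x n)

1<x⇒0<x : ∀ {x} → 1ᴿ <ᴿ x → 0ᴿ <ᴿ x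
1<x⇒0<x {x} (ε , 0<ε , N , f) = away⇒0<ᴿ {x} ε 0<ε
  (N , λ n n≥ → <-trans
    (subst (_< 1ℚ + ε) (+-identityˡ ε) (+-monoˡ-< ε 0<1ℚ)) (f n n≥))

1≤x⇒0<x+ε : ∀ {x ε} → 1ᴿ ≤ᴿ x → 0ᴿ <ᴿ ε → 0ᴿ <ᴿ x +ᴿ ε
1≤x⇒0<x+ε {x} {ε} 1≤x 0<ε =
  let (c , 0<c , M , f) = 0<ᴿ⇒away {ε} 0<ε
      (N , g) = cauchy x ½ (positive⁻¹ ½)
      0≤x : ∀ k → N ℕ.≤ k → 0ℚ ≤ seq x k
      0≤x k k≥ = ≮⇒≥ λ xk<0 → 1≤x (½ , positive⁻¹ ½ , N , λ n n≥ →
        +-monoˡ-< ½ (≤-<-trans (p≤∣p-q∣+q (seq x n) (seq x k))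
          (+-mono-< (g n k n≥ k≥) xk<0)))
  in away⇒0<ᴿ {x +ᴿ ε} c 0<c
    (M ℕ.⊔ N , λ n n≥ →
      subst (_< seq x n + seq ε n) (+-identityˡ c)
        (+-mono-≤-< (0≤x n (ℕₚ.m⊔n≤o⇒n≤o M N n≥)) (f n (ℕₚ.m⊔n≤o⇒m≤o M N n≥))))

partialSum : (ℕ → ℝ) → ℕ → ℝ
partialSum f zero    = 0ᴿ
partialSum f (suc n) = partialSum f n +ᴿ f n

HasSum : (ℕ → ℝ) → ℝ → Set
HasSum f s = ∀ ε → 0ᴿ <ᴿ ε → Eventually λ n → ∣ partialSum f n -ᴿ s ∣ᴿ <ᴿ ε

Irrational : ℝ → Set
Irrational α = ∀ r → ¬ (α ≃ᴿ fromℚ r)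

AdmissibleBase : ℝ → (β : ℝ) → 1ᴿ ≤ᴿ β → Set
AdmissibleBase α β 1≤β = ∀ ε (0<ε : 0ᴿ <ᴿ ε) →
  ∃[ q₀ ] (1 ℕ.≤ q₀ × ∀ p q .{{_ : NonZero q}} → q₀ ℕ.≤ q →
    1/ (β +ᴿ ε) ^ q ⟨ 1≤x⇒0<x+ε {β} {ε} 1≤β 0<ε ⟩
      <ᴿ ∣ α -ᴿ fromℚ (p / q) ∣ᴿ)

-- β is the least admissible base, i.e. the irrationality base of α is
-- finite and equal to β (meaningful for irrational α).
IrrationalityBase : ℝ → ℝ → Set
IrrationalityBase α β =
  Σ[ 1≤β ∈ 1ᴿ ≤ᴿ β ]
    (AdmissibleBase α β 1≤β ×
     (∀ β′ (1≤β′ : 1ᴿ ≤ᴿ β′) → AdmissibleBase α β′ 1≤β′ → β ≤ᴿ β′))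

-- Approximability to order ω involves ω(x) only at positive integers x,
-- so ω is given as a sequence (whose value at 0 is never used).
Approximable : ℝ → (ℕ → ℝ) → Set
Approximable θ ω = ∀ C → 0ᴿ <ᴿ C →
  ∃[ p ] ∃[ q ] Σ[ q≢0 ∈ NonZero q ]
    (C <ᴿ fromℚ (+ q / 1) × ∣ θ -ᴿ fromℚ (_/_ p q {{q≢0}}) ∣ᴿ <ᴿ ω q)

EventuallyFarFromRationals : ℝ → (β : ℝ) → 0ᴿ <ᴿ β → Set
EventuallyFarFromRationals τ β 0<β =
  ∃[ q₀ ] (∀ p q .{{_ : NonZero q}} → q₀ ℕ.≤ q →
    1/ β ^ q ⟨ 0<β ⟩ <ᴿ ∣ τ -ᴿ fromℚ (p / q) ∣ᴿ)

tower : ℕ → ℕ → ℕ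
tower b zero    = 1
tower b (suc n) = b ℕ.^ tower b n

{-# OPTIONS --safe #-}

-- Let w = a/b < 1 be in lowest terms, S n = Σ_{i<n} w^E(i+1) and Q n = b^E(n), the
-- reduced denominator of S n for n ≥ 1. Choose E so that w^E(n+1) equals β^(-Q n) up to
-- a factor 4: for β = b/a this is exact with E(n+1) = t_n, and for real β we
-- take w = 1/2. Then τ = Σ w^E(n+1) satisfies τ - S n ≤ 4b β^(-Q n), so no base
-- smaller than β is admissible.
--
-- For the lower bound let Q n ≤ q < Q(n+1). If p/q = S n, then τ - p/q exceeds
-- the next term w^E(n+1) ≥ β^(-q). If p/q ≠ S n and τ - S n is small against
-- 1/(q Q n), then |τ - p/q| ≥ 1/(2 q Q n). Otherwise w^E(n+1) is at least of order
-- 1/q², which makes Q(n+1) = b^E(n+1) polynomially bounded in q; since q < Q(n+1),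
-- p/q ≠ S(n+1) and |τ - p/q| ≥ 1/(2 q Q(n+1)). Both bounds are inverse polynomials
-- in q, so they beat β^(-q). A rational τ would equal
-- fractions of arbitrarily large denominator, contradicting this lower bound.

module Submission where

open import Defs
open import Data.Nat.Base as ℕ using (ℕ; zero; suc; NonZero; s≤s; z≤n)
import Data.Nat.Properties as ℕₚ
import Data.Nat.Divisibility as ℕᵈ
open import Data.Nat.Coprimality using (Coprime; coprime-divisor) renaming (sym to coprime-sym)
open import Data.Nat.Solver using (module +-*-Solver)
open import Data.Integer.Base as ℤ using (ℤ; +_)
import Data.Integer.Properties as ℤₚ
open import Data.Rational.Base hiding (NonZero)
open import Data.Rational.Properties
import Data.Rational.Unnormalised.Base as ℚᵘ
import Data.Rational.Unnormalised.Properties as ℚᵘₚ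
import Data.Rational.Solver as ℚSolver
open import Algebra.Bundles using (CommutativeRing)
open import Algebra.Properties.CommutativeSemiring.Exp
  (CommutativeRing.commutativeSemiring +-*-commutativeRing)
  using (_^_; ^-homo-*; ^-assocʳ; ^-distrib-*)
open import Data.Product.Base using (_×_; _,_; ∃-syntax; Σ-syntax; proj₁; proj₂)
open import Data.Sum.Base using (_⊎_; inj₁; inj₂)
open import Relation.Binary.PropositionalEquality
  using (_≡_; refl; sym; trans; cong; cong₂; subst; subst₂)
open import Relation.Nullary using (¬_; Dec; yes; no; contradiction)
open import Relation.Unary using (Decidable)

module ℕS = +-*-Solver
module ℚS = ℚSolver.+-*-Solver

-- Exponentials against polynomials

-- The inequality (1 + 1/(2m+1))² ≤ 1 + 1/m, raised to the power q: two estimates with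
-- base 1 + 1/(2m+1) multiply to one with base 1 + 1/m, whose degree is the sum.
square-step : ∀ m q → (2 ℕ.+ 2 ℕ.* m) ℕ.^ q ℕ.* (2 ℕ.+ 2 ℕ.* m) ℕ.^ q ℕ.* m ℕ.^ q
  ℕ.≤ suc m ℕ.^ q ℕ.* ((1 ℕ.+ 2 ℕ.* m) ℕ.^ q ℕ.* (1 ℕ.+ 2 ℕ.* m) ℕ.^ q)
square-step m zero = ℕₚ.≤-refl
square-step m (suc q) = subst₂ ℕ._≤_
  (solve 4 (λ a y m′ z → (a :* a :* m′) :* (y :* y :* z) := (a :* y) :* (a :* y) :* (m′ :* z)) refl
     (2 ℕ.+ 2 ℕ.* m) ((2 ℕ.+ 2 ℕ.* m) ℕ.^ q) m (m ℕ.^ q))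
  (solve 4 (λ s z c x → (s :* (c :* c)) :* (z :* (x :* x)) := (s :* z) :* ((c :* x) :* (c :* x))) refl
     (suc m) (suc m ℕ.^ q) (1 ℕ.+ 2 ℕ.* m) ((1 ℕ.+ 2 ℕ.* m) ℕ.^ q))
  (ℕₚ.*-mono-≤ base (square-step m q))
  where
  open ℕS
  base : (2 ℕ.+ 2 ℕ.* m) ℕ.* (2 ℕ.+ 2 ℕ.* m) ℕ.* m ℕ.≤ suc m ℕ.* ((1 ℕ.+ 2 ℕ.* m) ℕ.* (1 ℕ.+ 2 ℕ.* m))
  base = ℕₚ.m+n≤o⇒m≤o _ (ℕₚ.≤-reflexive
    (solve 1 (λ m → (con 2 :+ con 2 :* m) :* (con 2 :+ con 2 :* m) :* m :+ (con 1 :+ m)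
      := (con 1 :+ m) :* ((con 1 :+ con 2 :* m) :* (con 1 :+ con 2 :* m))) refl m))

-- Bernoulli's inequality `(1 + 1/m)^q ≥ 1 + q/m` with denominators cleared.
bernoulli : ∀ m q → (m ℕ.+ q) ℕ.* m ℕ.^ q ℕ.≤ m ℕ.* suc m ℕ.^ q
bernoulli m zero = ℕₚ.≤-reflexive (cong (ℕ._* 1) (ℕₚ.+-identityʳ m))
bernoulli m (suc q) = begin
  (m ℕ.+ suc q) ℕ.* (m ℕ.* x)
    -- The added `q * x` completes `(m + 1 + q) * m` to `(m + 1) * (m + q)`.
    ≤⟨ ℕₚ.m≤m+n _ (q ℕ.* x) ⟩
  (m ℕ.+ suc q) ℕ.* (m ℕ.* x) ℕ.+ q ℕ.* x
    ≡⟨ solve 3 (λ m q x → (m :+ (con 1 :+ q)) :* (m :* x) :+ q :* x := (con 1 :+ m) :* ((m :+ q) :* x)) refl m q x ⟩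
  suc m ℕ.* ((m ℕ.+ q) ℕ.* x)
    ≤⟨ ℕₚ.*-monoʳ-≤ (suc m) (bernoulli m q) ⟩
  suc m ℕ.* (m ℕ.* y)
    ≡⟨ solve 2 (λ m y → (con 1 :+ m) :* (m :* y) := m :* ((con 1 :+ m) :* y)) refl m y ⟩
  m ℕ.* (suc m ℕ.* y) ∎
  where
  open ℕₚ.≤-Reasoning
  open ℕS
  x = m ℕ.^ q
  y = suc m ℕ.^ q

-- Bernoulli for base `1 + 1/M`, squared, gives at least `q² / M²`, which is at least `q` once
-- `q ≥ M * M`; `square-step` returns to base `1 + 1/m`.
linear≤exponential : ∀ m .{{_ : NonZero m}} → ∃[ q₀ ] (∀ q → q₀ ℕ.≤ q → q ℕ.* m ℕ.^ q ℕ.≤ suc m ℕ.^ q)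
linear≤exponential m = M ℕ.* M , λ q q≥ →
  let x = M ℕ.^ q ; y = (2 ℕ.+ 2 ℕ.* m) ℕ.^ q ; z = m ℕ.^ q in
  ℕₚ.*-cancelˡ-≤ (M ℕ.* M ℕ.* (x ℕ.* x))
    {{ℕₚ.m*n≢0 (M ℕ.* M) (x ℕ.* x) {{_}} {{ℕₚ.m*n≢0 x x {{ℕₚ.m^n≢0 M q}} {{ℕₚ.m^n≢0 M q}}}}}}
    (begin
      M ℕ.* M ℕ.* (x ℕ.* x) ℕ.* (q ℕ.* z)
        ≡⟨ solve 4 (λ M x q z → M :* M :* (x :* x) :* (q :* z) := (M :* M) :* q :* (x :* x :* z)) refl M x q z ⟩
      (M ℕ.* M) ℕ.* q ℕ.* (x ℕ.* x ℕ.* z)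
        ≤⟨ ℕₚ.*-monoˡ-≤ (x ℕ.* x ℕ.* z) (ℕₚ.≤-trans (ℕₚ.*-monoˡ-≤ q q≥)
             (ℕₚ.*-mono-≤ (ℕₚ.m≤n+m q M) (ℕₚ.m≤n+m q M))) ⟩
      (M ℕ.+ q) ℕ.* (M ℕ.+ q) ℕ.* (x ℕ.* x ℕ.* z)
        ≡⟨ solve 3 (λ d x z → d :* d :* (x :* x :* z) := (d :* x) :* (d :* x) :* z) refl (M ℕ.+ q) x z ⟩
      ((M ℕ.+ q) ℕ.* x) ℕ.* ((M ℕ.+ q) ℕ.* x) ℕ.* z
        ≤⟨ ℕₚ.*-monoˡ-≤ z (ℕₚ.*-mono-≤ (bernoulli M q) (bernoulli M q)) ⟩
      (M ℕ.* y) ℕ.* (M ℕ.* y) ℕ.* z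
        ≡⟨ solve 3 (λ M y z → (M :* y) :* (M :* y) :* z := (M :* M) :* (y :* y :* z)) refl M y z ⟩
      (M ℕ.* M) ℕ.* (y ℕ.* y ℕ.* z)
        ≤⟨ ℕₚ.*-monoʳ-≤ (M ℕ.* M) (square-step m q) ⟩
      (M ℕ.* M) ℕ.* (suc m ℕ.^ q ℕ.* (x ℕ.* x))
        ≡⟨ solve 3 (λ M w x → (M :* M) :* (w :* (x :* x)) := M :* M :* (x :* x) :* w) refl M (suc m ℕ.^ q) x ⟩
      M ℕ.* M ℕ.* (x ℕ.* x) ℕ.* suc m ℕ.^ q ∎)
  where
  open ℕₚ.≤-Reasoning
  open ℕS
  M = 1 ℕ.+ 2 ℕ.* m

-- Induction on the degree: `square-step` splits base `1 + 1/m` into two copies of `1 + 1/(2m+1)`,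
-- one absorbing `C * q^J` and the other the last factor `q`.
polynomial≤exponential : ∀ J C m .{{_ : NonZero m}} →
  ∃[ q₀ ] (∀ q → q₀ ℕ.≤ q → C ℕ.* q ℕ.^ J ℕ.* m ℕ.^ q ℕ.≤ suc m ℕ.^ q)
polynomial≤exponential zero C m = C ℕ.* m , λ q q≥ → ℕₚ.*-cancelˡ-≤ m (begin
    m ℕ.* (C ℕ.* 1 ℕ.* m ℕ.^ q)
      ≡⟨ solve 3 (λ m C x → m :* (C :* con 1 :* x) := (C :* m) :* x) refl m C (m ℕ.^ q) ⟩
    (C ℕ.* m) ℕ.* m ℕ.^ q
      ≤⟨ ℕₚ.*-monoˡ-≤ (m ℕ.^ q) (ℕₚ.≤-trans q≥ (ℕₚ.m≤n+m q m)) ⟩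
    (m ℕ.+ q) ℕ.* m ℕ.^ q
      ≤⟨ bernoulli m q ⟩
    m ℕ.* suc m ℕ.^ q ∎)
  where
  open ℕₚ.≤-Reasoning
  open ℕS
polynomial≤exponential (suc J) C m = proj₁ P ℕ.⊔ proj₁ L , λ q q≥ →
  let x = (1 ℕ.+ 2 ℕ.* m) ℕ.^ q ; y = (2 ℕ.+ 2 ℕ.* m) ℕ.^ q ; z = m ℕ.^ q in
  ℕₚ.*-cancelˡ-≤ (x ℕ.* x)
    {{ℕₚ.m*n≢0 x x {{ℕₚ.m^n≢0 (1 ℕ.+ 2 ℕ.* m) q}} {{ℕₚ.m^n≢0 (1 ℕ.+ 2 ℕ.* m) q}}}}
    (begin
      x ℕ.* x ℕ.* (C ℕ.* (q ℕ.* q ℕ.^ J) ℕ.* z)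
        ≡⟨ solve 5 (λ x C q p z → x :* x :* (C :* (q :* p) :* z) := (C :* p :* x) :* (q :* x) :* z) refl
             x C q (q ℕ.^ J) z ⟩
      (C ℕ.* q ℕ.^ J ℕ.* x) ℕ.* (q ℕ.* x) ℕ.* z
        ≤⟨ ℕₚ.*-monoˡ-≤ z (ℕₚ.*-mono-≤
             (proj₂ P q (ℕₚ.m⊔n≤o⇒m≤o _ _ q≥))
             (proj₂ L q (ℕₚ.m⊔n≤o⇒n≤o (proj₁ P) _ q≥))) ⟩
      y ℕ.* y ℕ.* z
        ≤⟨ square-step m q ⟩
      suc m ℕ.^ q ℕ.* (x ℕ.* x)
        ≡⟨ ℕₚ.*-comm (suc m ℕ.^ q) (x ℕ.* x) ⟩
      x ℕ.* x ℕ.* suc m ℕ.^ q ∎)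
  where
  open ℕₚ.≤-Reasoning
  open ℕS
  P = polynomial≤exponential J C (1 ℕ.+ 2 ℕ.* m)
  L = linear≤exponential (1 ℕ.+ 2 ℕ.* m)

-- Growth, bounded search and coprimality of powers

n<b^n : ∀ b → 1 ℕ.< b → ∀ n → n ℕ.< b ℕ.^ n
n<b^n b 1<b zero    = ℕₚ.≤-refl
n<b^n b 1<b (suc n) = ℕₚ.≤-<-trans (n<b^n b 1<b n) (ℕₚ.^-monoʳ-< b 1<b (ℕₚ.n<1+n n))

-- A downward search; it places `q` between consecutive denominators and a rational between
-- consecutive shifted powers of 2.
last-before : ∀ {P : ℕ → Set} → Decidable P → ∀ n d → P n → ¬ P (d ℕ.+ n) →
  ∃[ k ] (n ℕ.≤ k × P k × ¬ P (suc k))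
last-before P? n zero    p ¬p = contradiction p ¬p
last-before P? n (suc d) p ¬p with P? (d ℕ.+ n)
... | yes p′ = d ℕ.+ n , ℕₚ.m≤n+m n d , p′ , ¬p
... | no ¬p′ = last-before P? n d p ¬p′

coprime-*ˡ : ∀ {m n k} → Coprime m k → Coprime n k → Coprime (m ℕ.* n) k
coprime-*ˡ {m} {n} {k} cm cn {d} (d∣mn , d∣k) = cn
  (coprime-divisor {d} {m} {n} (λ { (e∣d , e∣m) → cm (e∣m , ℕᵈ.∣-trans e∣d d∣k) }) d∣mn , d∣k)

coprime-^ˡ : ∀ {m k} → Coprime m k → ∀ e → Coprime (m ℕ.^ e) k
coprime-^ˡ c zero    (d∣1 , _) = ℕᵈ.∣1⇒≡1 d∣1
coprime-^ˡ {m} {k} c (suc e) = coprime-*ˡ {m} {m ℕ.^ e} {k} c (coprime-^ˡ {m} {k} c e)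

coprime-*+ : ∀ {b n} x → Coprime b n → Coprime b (x ℕ.* b ℕ.+ n)
coprime-*+ {b} {n} x c {d} (d∣b , d∣s) = c (d∣b , ℕᵈ.∣m+n∣m⇒∣n d∣s (ℕᵈ.∣n⇒∣m*n x d∣b))

-- Integers as rationals

abstract
  -- Being abstract, it is reached only through `fromℤ≡/1` and `toℚᵘ-fromℤ`, so the normalisation
  -- inside `i / 1` does not unfold.
  fromℤ : ℤ → ℚ
  fromℤ i = i / 1

  fromℤ≡/1 : ∀ i → fromℤ i ≡ i / 1
  fromℤ≡/1 i = refl

  toℚᵘ-fromℤ : ∀ i → toℚᵘ (fromℤ i) ℚᵘ.≃ ℚᵘ.mkℚᵘ i 0
  toℚᵘ-fromℤ i = toℚᵘ-fromℚᵘ (ℚᵘ.mkℚᵘ i 0)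

fromℕ : ℕ → ℚ
fromℕ n = fromℤ (+ n)

fromℕ-0 : fromℕ 0 ≡ 0ℚ
fromℕ-0 = fromℤ≡/1 (+ 0)

fromℕ-1 : fromℕ 1 ≡ 1ℚ
fromℕ-1 = fromℤ≡/1 (+ 1)

fromℤ-* : ∀ i j → fromℤ (i ℤ.* j) ≡ fromℤ i * fromℤ j
fromℤ-* i j = toℚᵘ-injective (ℚᵘₚ.≃-trans (toℚᵘ-fromℤ (i ℤ.* j))
  (ℚᵘₚ.≃-sym (ℚᵘₚ.≃-trans (toℚᵘ-homo-* (fromℤ i) (fromℤ j))
    (ℚᵘₚ.*-cong (toℚᵘ-fromℤ i) (toℚᵘ-fromℤ j)))))

fromℤ-+ : ∀ i j → fromℤ (i ℤ.+ j) ≡ fromℤ i + fromℤ j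
fromℤ-+ i j = toℚᵘ-injective (ℚᵘₚ.≃-trans (toℚᵘ-fromℤ (i ℤ.+ j))
  (ℚᵘₚ.≃-sym (ℚᵘₚ.≃-trans (toℚᵘ-homo-+ (fromℤ i) (fromℤ j))
    (ℚᵘₚ.≃-trans (ℚᵘₚ.+-cong (toℚᵘ-fromℤ i) (toℚᵘ-fromℤ j))
      (ℚᵘₚ.≃-reflexive (cong₂ (λ x y → ℚᵘ.mkℚᵘ (x ℤ.+ y) 0) (ℤₚ.*-identityʳ i) (ℤₚ.*-identityʳ j)))))))

fromℤ-neg : ∀ i → fromℤ (ℤ.- i) ≡ - fromℤ i
fromℤ-neg i = toℚᵘ-injective (ℚᵘₚ.≃-trans (toℚᵘ-fromℤ (ℤ.- i))
  (ℚᵘₚ.≃-sym (ℚᵘₚ.≃-trans (toℚᵘ-homo‿- (fromℤ i)) (ℚᵘₚ.-‿cong (toℚᵘ-fromℤ i)))))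

fromℤ-mono-≤ : ∀ {i j} → i ℤ.≤ j → fromℤ i ≤ fromℤ j
fromℤ-mono-≤ {i} {j} i≤j = toℚᵘ-cancel-≤
  (ℚᵘₚ.≤-respˡ-≃ (ℚᵘₚ.≃-sym (toℚᵘ-fromℤ i)) (ℚᵘₚ.≤-respʳ-≃ (ℚᵘₚ.≃-sym (toℚᵘ-fromℤ j))
    (ℚᵘ.*≤* (ℤₚ.*-monoʳ-≤-nonNeg (+ 1) i≤j))))

fromℤ-cancel-≤ : ∀ {i j} → fromℤ i ≤ fromℤ j → i ℤ.≤ j
fromℤ-cancel-≤ {i} {j} p = ℤₚ.≮⇒≥ λ j<i →
  <-irrefl {fromℤ j} refl (<-≤-trans (mono-< j<i) p)
  where
  mono-< : ∀ {i j} → i ℤ.< j → fromℤ i < fromℤ j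
  mono-< {i} {j} i<j = toℚᵘ-cancel-<
    (ℚᵘₚ.<-respˡ-≃ (ℚᵘₚ.≃-sym (toℚᵘ-fromℤ i)) (ℚᵘₚ.<-respʳ-≃ (ℚᵘₚ.≃-sym (toℚᵘ-fromℤ j))
      (ℚᵘ.*<* (ℤₚ.*-monoʳ-<-pos (+ 1) i<j))))

/-*-cancel : ∀ i n .{{_ : NonZero n}} → (i / n) * fromℕ n ≡ fromℤ i
/-*-cancel i n@(suc m) = toℚᵘ-injective
  (ℚᵘₚ.≃-trans (toℚᵘ-homo-* (i / n) (fromℕ n))
    (ℚᵘₚ.≃-trans (ℚᵘₚ.*-cong (toℚᵘ-fromℚᵘ (ℚᵘ.mkℚᵘ i m)) (toℚᵘ-fromℤ (+ n)))
      (ℚᵘₚ.≃-trans (ℚᵘ.*≡* (trans (ℤₚ.*-identityʳ (i ℤ.* + n)) (cong (λ k → i ℤ.* + k) (sym (ℕₚ.*-identityʳ n)))))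
        (ℚᵘₚ.≃-sym (toℚᵘ-fromℤ i)))))

fromℕ-* : ∀ m n → fromℕ (m ℕ.* n) ≡ fromℕ m * fromℕ n
fromℕ-* m n = trans (cong fromℤ (ℤₚ.pos-* m n)) (fromℤ-* (+ m) (+ n))

fromℕ-+ : ∀ m n → fromℕ (m ℕ.+ n) ≡ fromℕ m + fromℕ n
fromℕ-+ m n = trans (cong fromℤ (ℤₚ.pos-+ m n)) (fromℤ-+ (+ m) (+ n))

fromℕ-suc : ∀ n → fromℕ (suc n) ≡ 1ℚ + fromℕ n
fromℕ-suc n = trans (fromℕ-+ 1 n) (cong (_+ fromℕ n) fromℕ-1)

fromℕ-^ : ∀ m n → fromℕ (m ℕ.^ n) ≡ fromℕ m ^ n
fromℕ-^ m zero    = fromℕ-1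
fromℕ-^ m (suc n) = trans (fromℕ-* m (m ℕ.^ n)) (cong (fromℕ m *_) (fromℕ-^ m n))

fromℕ-mono-≤ : ∀ {m n} → m ℕ.≤ n → fromℕ m ≤ fromℕ n
fromℕ-mono-≤ m≤n = fromℤ-mono-≤ (ℤ.+≤+ m≤n)

fromℕ-cancel-≤ : ∀ {m n} → fromℕ m ≤ fromℕ n → m ℕ.≤ n
fromℕ-cancel-≤ p = ℤₚ.drop‿+≤+ (fromℤ-cancel-≤ p)

0≤fromℕ : ∀ n → 0ℚ ≤ fromℕ n
0≤fromℕ n = subst (_≤ fromℕ n) fromℕ-0 (fromℕ-mono-≤ z≤n)

1≤fromℕ-suc : ∀ n → 1ℚ ≤ fromℕ (suc n)
1≤fromℕ-suc n = subst (_≤ fromℕ (suc n)) fromℕ-1 (fromℕ-mono-≤ (s≤s (z≤n {n})))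

0<fromℕ : ∀ n .{{_ : NonZero n}} → 0ℚ < fromℕ n
0<fromℕ (suc n) = <-≤-trans 0<1ℚ (1≤fromℕ-suc n)

archimedean : ∀ p → ∃[ n ] p < fromℕ n
archimedean p@(mkℚ i d-1 _) = suc ℤ.∣ i ∣ , ≤-<-trans p≤∣i∣ ∣i∣<
  where
  d = suc d-1
  ∣i∣< : fromℕ ℤ.∣ i ∣ < fromℕ (suc ℤ.∣ i ∣)
  ∣i∣< = subst₂ _<_ (+-identityˡ (fromℕ ℤ.∣ i ∣)) (sym (fromℕ-suc ℤ.∣ i ∣)) (+-monoˡ-< (fromℕ ℤ.∣ i ∣) 0<1ℚ)
  i≤∣i∣ : ∀ i → i ℤ.≤ + ℤ.∣ i ∣
  i≤∣i∣ (+ n)        = ℤₚ.≤-refl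
  i≤∣i∣ ℤ.-[1+ n ]   = ℤ.-≤+
  p≤∣i∣ : p ≤ fromℕ ℤ.∣ i ∣
  p≤∣i∣ = *-cancelʳ-≤-pos (fromℕ d) {{positive (0<fromℕ d)}}
    (subst₂ _≤_ (trans (sym (/-*-cancel i d)) (cong (_* fromℕ d) (↥p/↧p≡p p))) (fromℕ-* ℤ.∣ i ∣ d)
      (fromℤ-mono-≤ (ℤₚ.≤-trans (i≤∣i∣ i) (ℤ.+≤+ (ℕₚ.m≤m*n ℤ.∣ i ∣ d)))))

-- Order and powers

*-mono-≤ : ∀ {p q r s} → 0ℚ ≤ p → 0ℚ ≤ s → p ≤ q → r ≤ s → p * r ≤ q * s
*-mono-≤ {p} {q} {r} {s} 0≤p 0≤s p≤q r≤s = ≤-trans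
  (*-monoˡ-≤-nonNeg p {{nonNegative 0≤p}} r≤s)
  (*-monoʳ-≤-nonNeg s {{nonNegative 0≤s}} p≤q)

*-monoˡ-≤′ : ∀ {p q} r → 0ℚ ≤ r → p ≤ q → p * r ≤ q * r
*-monoˡ-≤′ r 0≤r = *-monoʳ-≤-nonNeg r {{nonNegative 0≤r}}

*-monoʳ-≤′ : ∀ {p q} r → 0ℚ ≤ r → p ≤ q → r * p ≤ r * q
*-monoʳ-≤′ r 0≤r = *-monoˡ-≤-nonNeg r {{nonNegative 0≤r}}

*-cancelʳ-≤′ : ∀ {p q} r → 0ℚ < r → p * r ≤ q * r → p ≤ q
*-cancelʳ-≤′ r 0<r = *-cancelʳ-≤-pos r {{positive 0<r}}

0≤* : ∀ {p q} → 0ℚ ≤ p → 0ℚ ≤ q → 0ℚ ≤ p * q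
0≤* {p} {q} 0≤p 0≤q = subst (_≤ p * q) (*-zeroʳ p) (*-monoʳ-≤′ p 0≤p 0≤q)

0<^ : ∀ {p} n → 0ℚ < p → 0ℚ < p ^ n
0<^ zero    0<p = 0<1ℚ
0<^ (suc n) 0<p = 0<* 0<p (0<^ n 0<p)

1^≡1 : ∀ n → 1ℚ ^ n ≡ 1ℚ
1^≡1 zero    = refl
1^≡1 (suc n) = trans (*-identityˡ (1ℚ ^ n)) (1^≡1 n)

^-monoˡ-≤ : ∀ {p q} n → 0ℚ < p → p ≤ q → p ^ n ≤ q ^ n
^-monoˡ-≤ zero    0<p p≤q = ≤-refl
^-monoˡ-≤ (suc n) 0<p p≤q = *-mono-≤ (<⇒≤ 0<p) (<⇒≤ (0<^ n (<-≤-trans 0<p p≤q))) p≤q (^-monoˡ-≤ n 0<p p≤q)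

1≤^ : ∀ {p} n → 1ℚ ≤ p → 1ℚ ≤ p ^ n
1≤^ n 1≤p = subst (_≤ _ ^ n) (1^≡1 n) (^-monoˡ-≤ n 0<1ℚ 1≤p)

^≤1 : ∀ {p} n → 0ℚ < p → p ≤ 1ℚ → p ^ n ≤ 1ℚ
^≤1 n 0<p p≤1 = subst (_ ^ n ≤_) (1^≡1 n) (^-monoˡ-≤ n 0<p p≤1)

^-monoʳ-≤ : ∀ {p m n} → 1ℚ ≤ p → m ℕ.≤ n → p ^ m ≤ p ^ n
^-monoʳ-≤ {p} {m} {n} 1≤p m≤n = subst₂ _≤_ (*-identityʳ (p ^ m))
  (trans (sym (^-homo-* p m (n ℕ.∸ m))) (cong (p ^_) (ℕₚ.m+[n∸m]≡n m≤n)))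
  (*-monoʳ-≤′ (p ^ m) (<⇒≤ (0<^ m (<-≤-trans 0<1ℚ 1≤p))) (1≤^ (n ℕ.∸ m) 1≤p))

^-antimonoʳ-≤ : ∀ {p m n} → 0ℚ < p → p ≤ 1ℚ → m ℕ.≤ n → p ^ n ≤ p ^ m
^-antimonoʳ-≤ {p} {m} {n} 0<p p≤1 m≤n = subst₂ _≤_
  (trans (sym (^-homo-* p m (n ℕ.∸ m))) (cong (p ^_) (ℕₚ.m+[n∸m]≡n m≤n))) (*-identityʳ (p ^ m))
  (*-monoʳ-≤′ (p ^ m) (<⇒≤ (0<^ m 0<p)) (^≤1 (n ℕ.∸ m) 0<p p≤1))

inv≤ : ∀ {p c} → 0ℚ < p → 1ℚ ≤ c * p → inv p ≤ c
inv≤ {p} {c} 0<p 1≤cp = *-cancelʳ-≤′ p 0<p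
  (subst (_≤ c * p) (sym (trans (*-comm (inv p) p) (*-inv 0<p))) 1≤cp)

≤inv : ∀ {p c} → 0ℚ < p → c * p ≤ 1ℚ → c ≤ inv p
≤inv {p} {c} 0<p cp≤1 = *-cancelʳ-≤′ p 0<p
  (subst (c * p ≤_) (sym (trans (*-comm (inv p) p) (*-inv 0<p))) cp≤1)

inv-antimono-≤ : ∀ {p q} → 0ℚ < p → p ≤ q → inv q ≤ inv p
inv-antimono-≤ {p} {q} 0<p p≤q = inv≤ (<-≤-trans 0<p p≤q)
  (subst (_≤ inv p * q) (trans (*-comm (inv p) p) (*-inv 0<p)) (*-monoʳ-≤′ (inv p) (<⇒≤ (0<inv 0<p)) p≤q))

inv-unique : ∀ {p c} → 0ℚ < p → c * p ≡ 1ℚ → inv p ≡ c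
inv-unique 0<p e = ≤-antisym (inv≤ 0<p (≤-reflexive (sym e))) (≤inv 0<p (≤-reflexive e))

≤⇒0≤- : ∀ {p q} → p ≤ q → 0ℚ ≤ q - p
≤⇒0≤- {p} {q} p≤q = subst (_≤ q - p) (+-inverseʳ p) (+-monoˡ-≤ (- p) p≤q)

-- Carries an estimate between natural numbers over to rationals: `p` is at least `(m + 1) / m`,
-- whose `q`-th power is at least `D`.
^-lower-bound : ∀ {p x} m D q .{{_ : NonZero m}} → fromℕ (suc m) ≤ p * fromℕ m →
  D ℕ.* m ℕ.^ q ℕ.≤ suc m ℕ.^ q → x ≤ fromℕ D → x ≤ p ^ q
^-lower-bound {p} {x} m D q m+1≤pm Dm^q≤ x≤D = ≤-trans x≤D (*-cancelʳ-≤′ (fromℕ m ^ q) (0<^ q (0<fromℕ m))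
  (≤-trans
    (subst₂ _≤_ (trans (fromℕ-* D (m ℕ.^ q)) (cong (fromℕ D *_) (fromℕ-^ m q))) (fromℕ-^ (suc m) q) (fromℕ-mono-≤ Dm^q≤))
    (subst (fromℕ (suc m) ^ q ≤_) (^-distrib-* p (fromℕ m) q) (^-monoˡ-≤ q (0<fromℕ (suc m)) m+1≤pm))))

-- Any `m` above `1 / c` works. It depends on `c` alone, so it serves all late terms of a sequence
-- bounded below by `1 + c`.
1<⇒[m+1]/m≤ : ∀ c → 0ℚ < c → ∃[ m ] (NonZero m × ∀ p → 1ℚ + c ≤ p → fromℕ (suc m) ≤ p * fromℕ m)
1<⇒[m+1]/m≤ c 0<c with archimedean (inv c)
... | zero , inv<0 = contradiction (<-trans (0<inv 0<c) inv<0) (<-irrefl (sym fromℕ-0))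
... | m@(suc _) , inv<m = m , _ , λ p 1+c≤p → ≤-trans
  (subst₂ _≤_ (sym (fromℕ-suc m)) (sym (*-distribʳ-+ (fromℕ m) 1ℚ c))
    (subst (λ z → 1ℚ + fromℕ m ≤ z + c * fromℕ m) (sym (*-identityˡ (fromℕ m)))
      (subst (_≤ fromℕ m + c * fromℕ m) (+-comm (fromℕ m) 1ℚ)
        (+-monoʳ-≤ (fromℕ m) (subst (_≤ c * fromℕ m) (*-inv 0<c) (*-monoʳ-≤′ c (<⇒≤ 0<c) (<⇒≤ inv<m)))))))
  (*-monoˡ-≤′ (fromℕ m) (0≤fromℕ m) 1+c≤p)

-- Separation of distinct rationals

0∨1≤∣fromℤ∣ : ∀ i → i ≡ + 0 ⊎ 1ℚ ≤ ∣ fromℤ i ∣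
0∨1≤∣fromℤ∣ (+ zero) = inj₁ refl
0∨1≤∣fromℤ∣ (+ suc n) = inj₂ (≤-trans (1≤fromℕ-suc n) (p≤∣p∣ _))
0∨1≤∣fromℤ∣ ℤ.-[1+ n ] = inj₂ (subst (1ℚ ≤_)
  (trans (cong ∣_∣ (fromℤ-neg ℤ.-[1+ n ])) (∣-p∣≡∣p∣ (fromℤ ℤ.-[1+ n ])))
  (≤-trans (1≤fromℕ-suc n) (p≤∣p∣ _)))

-- Two fractions differ by an integer over `q * Q`, and a nonzero integer has absolute value at
-- least 1.
separation : ∀ {x y i j} q Q .{{_ : NonZero q}} .{{_ : NonZero Q}} →
  x * fromℕ q ≡ fromℤ i → y * fromℕ Q ≡ fromℤ j →
  i ℤ.* + Q ≡ j ℤ.* + q ⊎ 1ℚ ≤ ∣ x - y ∣ * (fromℕ q * fromℕ Q)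
separation {x} {y} {i} {j} q Q xq≡i yQ≡j with 0∨1≤∣fromℤ∣ (i ℤ.* + Q ℤ.- j ℤ.* + q)
... | inj₁ e = inj₁ (ℤₚ.i-j≡0⇒i≡j (i ℤ.* + Q) (j ℤ.* + q) e)
... | inj₂ 1≤ = inj₂ (subst (1ℚ ≤_) (trans (cong ∣_∣ eq) abs) 1≤)
  where
  D = fromℕ q * fromℕ Q
  0≤D = 0≤* (0≤fromℕ q) (0≤fromℕ Q)
  eq : fromℤ (i ℤ.* + Q ℤ.- j ℤ.* + q) ≡ (x - y) * D
  eq = trans (fromℤ-+ (i ℤ.* + Q) (ℤ.- (j ℤ.* + q)))
    (trans (cong₂ _+_ (fromℤ-* i (+ Q)) (trans (fromℤ-neg (j ℤ.* + q)) (cong -_ (fromℤ-* j (+ q)))))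
      (trans (cong₂ (λ u v → u * fromℕ Q - v * fromℕ q) (sym xq≡i) (sym yQ≡j))
        (ℚS.solve 4 (λ x y a b → x :* a :* b :- y :* b :* a := (x :- y) :* (a :* b)) refl x y (fromℕ q) (fromℕ Q))))
    where open ℚS
  abs : ∣ (x - y) * D ∣ ≡ ∣ x - y ∣ * D
  abs = trans (∣p*q∣≡∣p∣*∣q∣ (x - y) D) (cong (∣ x - y ∣ *_) (0≤p⇒∣p∣≡p 0≤D))

-- Real numbers

infixr 4 _∩_
_∩_ : ∀ {P Q : ℕ → Set} → Eventually P → Eventually Q → Eventually (λ n → P n × Q n)
(M , f) ∩ (N , g) = M ℕ.⊔ N , λ n n≥ → f n (ℕₚ.m⊔n≤o⇒m≤o M N n≥) , g n (ℕₚ.m⊔n≤o⇒n≤o M N n≥)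

eventually-map : ∀ {P Q : ℕ → Set} → (∀ n → P n → Q n) → Eventually P → Eventually Q
eventually-map h (N , f) = N , λ n n≥ → h n (f n n≥)

eventually⇒∃ : ∀ {P : ℕ → Set} → Eventually P → ∃[ n ] P n
eventually⇒∃ (N , f) = N , f N ℕₚ.≤-refl

p<p+q : ∀ {q} p → 0ℚ < q → p < p + q
p<p+q {q} p 0<q = subst (_< p + q) (+-identityʳ p) (+-monoʳ-< p 0<q)

p<q+p : ∀ {q} p → 0ℚ < q → p < q + p
p<q+p {q} p 0<q = subst (_< q + p) (+-identityˡ p) (+-monoˡ-< p 0<q)

seq-^ : ∀ x n k → seq (x ^ᴿ n) k ≡ seq x k ^ n
seq-^ x zero    k = refl
seq-^ x (suc n) k = cong (seq x k *_) (seq-^ x n k)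

seq-1/^ : ∀ x n (0<x : 0ᴿ <ᴿ x) k → seq (1/ x ^ n ⟨ 0<x ⟩) k ≡ inv (seq x k ^ n)
seq-1/^ x n 0<x k = cong inv (seq-^ x n k)

<ᴿ-asym : ∀ {x y} → x <ᴿ y → ¬ y <ᴿ x
<ᴿ-asym {x} {y} (ε , 0<ε , f) (δ , 0<δ , g) =
  let (k , x+ε<y , y+δ<x) = eventually⇒∃ {λ k → seq x k + ε < seq y k × seq y k + δ < seq x k} (f ∩ g)
  in <-irrefl {seq x k} refl (<-trans (<-trans (p<p+q (seq x k) 0<ε) x+ε<y) (<-trans (p<p+q (seq y k) 0<δ) y+δ<x))

eventually-0< : ∀ {x} → 0ᴿ <ᴿ x → Eventually λ k → 0ℚ < seq x k
eventually-0< {x} 0<x =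
  let (ε , 0<ε , f) = 0<ᴿ⇒away {x} 0<x in eventually-map (λ k ε<x → <-trans 0<ε ε<x) f

-- The bound `|τ - p/q| ≤ C β^(-q)` for arbitrarily large `q`, cleared of `β^(-q)`. One `C` serves
-- all `q`, while the index from which the bound holds may depend on the fraction.
InfinitelyOftenNear : ℝ → ℝ → Set
InfinitelyOftenNear τ β = ∃[ C ] (∀ N →
  ∃[ p ] ∃[ q ] Σ[ q≢0 ∈ NonZero q ] (N ℕ.≤ q ×
    Eventually λ k → ∣ seq τ k - _/_ p q {{q≢0}} ∣ * seq β k ^ q ≤ fromℕ C))

-- The unfolded form of `1/ β ^ q ⟨ 0<β ⟩ <ᴿ ∣ τ -ᴿ fromℚ (p / q) ∣ᴿ`, free of the positivity proof.
Far : ℝ → ℝ → ℤ → (q : ℕ) → .{{NonZero q}} → Set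
Far τ β p q = ∃[ ε ] (0ℚ < ε × Eventually λ k → inv (seq β k ^ q) + ε < ∣ seq τ k - p / q ∣)

module _ {τ β : ℝ} (0<β : 0ᴿ <ᴿ β) where

  <ᴿ⇒far : ∀ p q .{{_ : NonZero q}} → 1/ β ^ q ⟨ 0<β ⟩ <ᴿ ∣ τ -ᴿ fromℚ (p / q) ∣ᴿ → Far τ β p q
  <ᴿ⇒far p q (ε , 0<ε , f) = ε , 0<ε , eventually-map
    (λ k → subst (λ z → z + ε < ∣ seq τ k - p / q ∣) (seq-1/^ β q 0<β k)) f

  far⇒<ᴿ : ∀ p q .{{_ : NonZero q}} → Far τ β p q → 1/ β ^ q ⟨ 0<β ⟩ <ᴿ ∣ τ -ᴿ fromℚ (p / q) ∣ᴿ
  far⇒<ᴿ p q (ε , 0<ε , f) = ε , 0<ε , eventually-map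
    (λ k → subst (λ z → z + ε < ∣ seq τ k - p / q ∣) (sym (seq-1/^ β q 0<β k))) f

-- From distance bounds to irrationality and the irrationality base

/-scale : ∀ r s .{{_ : NonZero s}} .{{_ : NonZero (↧ₙ r ℕ.* s)}} → (↥ r ℤ.* + s) / (↧ₙ r ℕ.* s) ≡ r
/-scale r s = ≤-antisym
  (*-cancelʳ-≤′ (fromℕ (↧ₙ r ℕ.* s)) (0<fromℕ (↧ₙ r ℕ.* s)) (≤-reflexive eq))
  (*-cancelʳ-≤′ (fromℕ (↧ₙ r ℕ.* s)) (0<fromℕ (↧ₙ r ℕ.* s)) (≤-reflexive (sym eq)))
  where
  eq : ((↥ r ℤ.* + s) / (↧ₙ r ℕ.* s)) * fromℕ (↧ₙ r ℕ.* s) ≡ r * fromℕ (↧ₙ r ℕ.* s)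
  eq = trans (/-*-cancel (↥ r ℤ.* + s) (↧ₙ r ℕ.* s))
    (trans (fromℤ-* (↥ r) (+ s))
      (trans (cong (_* fromℕ s) (trans (sym (/-*-cancel (↥ r) (↧ₙ r))) (cong (_* fromℕ (↧ₙ r)) (↥p/↧p≡p r))))
        (trans (*-assoc r (fromℕ (↧ₙ r)) (fromℕ s)) (cong (r *_) (sym (fromℕ-* (↧ₙ r) s))))))

-- A rational `r` can be written with a denominator beyond `q₀`; farness then keeps `τ` away from
-- `r` by a fixed `ε`.
far⇒irrational : ∀ {τ β} → (0<β : 0ᴿ <ᴿ β) → EventuallyFarFromRationals τ β 0<β → Irrational τ
far⇒irrational {τ} {β} 0<β (q₀ , far) r τ≃r = <-irrefl {ε} refl (<-trans ε<d d<ε)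
  where
  s = suc q₀
  q = ↧ₙ r ℕ.* s
  instance
    q≢0 : NonZero q
    q≢0 = ℕₚ.m*n≢0 (↧ₙ r) s
  p = ↥ r ℤ.* + s
  F : Far τ β p q
  F = <ᴿ⇒far {τ} {β} 0<β p q (far p q (ℕₚ.≤-trans (ℕₚ.n≤1+n q₀) (ℕₚ.m≤n*m s (↧ₙ r))))
  ε = proj₁ F
  K = eventually⇒∃ {λ k → 0ℚ < seq β k × inv (seq β k ^ q) + ε < ∣ seq τ k - p / q ∣ × ∣ seq τ k - r ∣ < ε}
    (eventually-0< {β} 0<β ∩ proj₂ (proj₂ F) ∩ τ≃r ε (proj₁ (proj₂ F)))
  k = proj₁ K
  d<ε : ∣ seq τ k - r ∣ < ε
  d<ε = proj₂ (proj₂ (proj₂ K))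
  ε<d : ε < ∣ seq τ k - r ∣
  ε<d = <-trans (p<q+p ε (0<inv (0<^ q (proj₁ (proj₂ K)))))
    (subst (λ z → inv (seq β k ^ q) + ε < ∣ seq τ k - z ∣) (/-scale r s) (proj₁ (proj₂ (proj₂ K))))

-- Asking for `q > q₀ + 1` puts the promised approximation in the range where the opposite
-- inequality holds.
far⇒¬approximable : ∀ {τ β} → (0<β : 0ᴿ <ᴿ β) → EventuallyFarFromRationals τ β 0<β →
  ¬ Approximable τ (λ q → 1/ β ^ q ⟨ 0<β ⟩)
far⇒¬approximable {τ} {β} 0<β (q₀ , far) approx = go (approx (fromℚ (fromℕ (suc q₀))) 0<C)
  where
  0<C : 0ᴿ <ᴿ fromℚ (fromℕ (suc q₀))
  0<C = away⇒0<ᴿ {fromℚ (fromℕ (suc q₀))} ½ (positive⁻¹ ½)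
    (0 , λ _ _ → <-≤-trans (subst₂ _<_ (+-identityʳ ½) (½*+½*≡ 1ℚ) (+-monoʳ-< ½ (positive⁻¹ ½))) (1≤fromℕ-suc q₀))
  C<q⇒q₀≤q : ∀ q → fromℚ (fromℕ (suc q₀)) <ᴿ fromℚ (+ q / 1) → q₀ ℕ.≤ q
  C<q⇒q₀≤q q (ε , 0<ε , N , f) = ℕₚ.≤-trans (ℕₚ.n≤1+n q₀) (fromℕ-cancel-≤
    (<⇒≤ (<-trans (p<p+q (fromℕ (suc q₀)) 0<ε) (subst (fromℕ (suc q₀) + ε <_) (sym (fromℤ≡/1 (+ q))) (f N ℕₚ.≤-refl)))))
  go : ¬ (∃[ p ] ∃[ q ] Σ[ q≢0 ∈ NonZero q ]
    (fromℚ (fromℕ (suc q₀)) <ᴿ fromℚ (+ q / 1) × ∣ τ -ᴿ fromℚ (_/_ p q {{q≢0}}) ∣ᴿ <ᴿ 1/ β ^ q ⟨ 0<β ⟩))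
  go (p , q , q≢0 , C<q , near) =
    <ᴿ-asym {∣ τ -ᴿ fromℚ (_/_ p q {{q≢0}}) ∣ᴿ} {1/ β ^ q ⟨ 0<β ⟩} near (far p q {{q≢0}} (C<q⇒q₀≤q q C<q))

-- Enlarging the base only lowers the threshold, so the margin `δ` is kept; `suc q₀` meets the
-- demand for a positive index.
far⇒admissible : ∀ {τ β} → (0<β : 0ᴿ <ᴿ β) (1≤β : 1ᴿ ≤ᴿ β) →
  EventuallyFarFromRationals τ β 0<β → AdmissibleBase τ β 1≤β
far⇒admissible {τ} {β} 0<β 1≤β (q₀ , far) ε 0<ε = suc q₀ , s≤s z≤n , λ p q q₀<q →
  far⇒<ᴿ {τ} {β +ᴿ ε} (1≤x⇒0<x+ε {β} {ε} 1≤β 0<ε) p q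
    (weaken p q (<ᴿ⇒far {τ} {β} 0<β p q (far p q (ℕₚ.<⇒≤ q₀<q))))
  where
  inv-≤ : ∀ {b e} q → 0ℚ < b → 0ℚ < e → inv ((b + e) ^ q) ≤ inv (b ^ q)
  inv-≤ {b} q 0<b 0<e = inv-antimono-≤ (0<^ q 0<b) (^-monoˡ-≤ q 0<b (<⇒≤ (p<p+q b 0<e)))
  weaken : ∀ p q .{{_ : NonZero q}} → Far τ β p q → Far τ (β +ᴿ ε) p q
  weaken p q (δ , 0<δ , f) = δ , 0<δ , eventually-map
    (λ k (0<b , 0<e , lt) → ≤-<-trans (+-monoˡ-≤ δ (inv-≤ q 0<b 0<e)) lt)
    (eventually-0< {β} 0<β ∩ eventually-0< {ε} 0<ε ∩ f)

-- If y + h ≤ z ≤ B then z / y ≥ 1 + h / B, whose powers are unbounded.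
power-gap : ∀ {B h} C → 0ℚ < B → 0ℚ < h → ∃[ q₀ ] (∀ q {y z} → q₀ ℕ.≤ q →
  0ℚ < y → y + h ≤ z → z ≤ B → fromℕ C * y ^ q ≤ z ^ q)
power-gap {B} {h} C 0<B 0<h = q₀ , λ q q≥ 0<y y+h≤z z≤B → ≤-trans
  (*-monoˡ-≤′ _ (<⇒≤ (0<^ q 0<y))
    (^-lower-bound {1ℚ + c} m (C ℕ.* 1) q (bound (1ℚ + c) ≤-refl) (grow q q≥) (≤-reflexive (cong fromℕ (sym (ℕₚ.*-identityʳ C))))))
  (subst (_≤ _) (^-distrib-* (1ℚ + c) _ q) (^-monoˡ-≤ q (0<* (<-trans 0<c (p<q+p c 0<1ℚ)) 0<y) (scaled 0<y y+h≤z z≤B)))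
  where
  c = h * inv B
  0<c = 0<* 0<h (0<inv 0<B)
  G = 1<⇒[m+1]/m≤ c 0<c
  m = proj₁ G
  instance
    m≢0 : NonZero m
    m≢0 = proj₁ (proj₂ G)
  bound = proj₂ (proj₂ G)
  q₀ = proj₁ (polynomial≤exponential 0 C m)
  grow = proj₂ (polynomial≤exponential 0 C m)
  scaled : ∀ {y z} → 0ℚ < y → y + h ≤ z → z ≤ B → (1ℚ + c) * y ≤ z
  scaled {y} {z} 0<y y+h≤z z≤B = ≤-trans
    (subst₂ _≤_ (sym (trans (*-distribʳ-+ y 1ℚ c) (cong (_+ c * y) (*-identityˡ y))))
      (cong (λ t → y + t) (trans (*-assoc h (inv B) B) (trans (cong (h *_) (trans (*-comm (inv B) B) (*-inv 0<B))) (*-identityʳ h))))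
      (+-monoʳ-≤ y (*-monoʳ-≤′ c (<⇒≤ 0<c) (≤-trans (≤-trans (<⇒≤ (p<p+q y 0<h)) y+h≤z) z≤B))))
    y+h≤z

-- If `β′ + η < β`, admissibility of `β′` gives `(β′ + η/2)^(-q) < |τ - p/q| ≤ C β^(-q)` for some
-- large `q`, whereas `power-gap` makes `β^q` at least `C (β′ + η/2)^q`.
far∧near⇒irrationalityBase : ∀ {τ β} → (1<β : 1ᴿ <ᴿ β) →
  EventuallyFarFromRationals τ β (1<x⇒0<x {β} 1<β) → InfinitelyOftenNear τ β → IrrationalityBase τ β
far∧near⇒irrationalityBase {τ} {β} 1<β far (C , near) =
  1≤β , far⇒admissible {τ} {β} (1<x⇒0<x {β} 1<β) 1≤β far , least
  where
  1≤β : 1ᴿ ≤ᴿ β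
  1≤β = <ᴿ-asym {1ᴿ} {β} 1<β
  -- Multiplying `lt` through by `b ^ q` gives `C ≤ inv (y ^ q) * b ^ q < d * b ^ q ≤ C`.
  clash : ∀ {y b d ε} q → 0ℚ < y → 0ℚ < b → 0ℚ < ε → fromℕ C * y ^ q ≤ b ^ q →
    d * b ^ q ≤ fromℕ C → ¬ inv (y ^ q) + ε < d
  clash {y} {b} {d} {ε} q 0<y 0<b 0<ε Cy≤b db≤C lt = <-irrefl {fromℕ C} refl (<-≤-trans
    (≤-<-trans
      (subst (_≤ inv (y ^ q) * b ^ q)
        (trans (cong (inv (y ^ q) *_) (*-comm (fromℕ C) (y ^ q)))
          (trans (sym (*-assoc (inv (y ^ q)) (y ^ q) (fromℕ C)))
            (trans (cong (_* fromℕ C) (trans (*-comm (inv (y ^ q)) (y ^ q)) (*-inv (0<^ q 0<y)))) (*-identityˡ (fromℕ C)))))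
        (*-monoʳ-≤′ (inv (y ^ q)) (<⇒≤ (0<inv (0<^ q 0<y))) Cy≤b))
      (*-monoˡ-<-pos (b ^ q) {{positive (0<^ q 0<b)}} (<-trans (p<p+q (inv (y ^ q)) 0<ε) lt)))
    db≤C)
  least : ∀ β′ (1≤β′ : 1ᴿ ≤ᴿ β′) → AdmissibleBase τ β′ 1≤β′ → β ≤ᴿ β′
  least β′ 1≤β′ admissible (η , 0<η , β′+η<β) = go (near (q₀ ℕ.⊔ proj₁ G))
    where
    -- Half of `η` is spent on admissibility; the other half remains as the gap for `power-gap`.
    h = ½ * η
    0<h = 0<½* 0<η
    ε = fromℚ h
    0<ε : 0ᴿ <ᴿ ε
    0<ε = away⇒0<ᴿ {ε} (½ * h) (0<½* 0<h) (0 , λ _ _ → subst (½ * h <_) (½*+½*≡ h) (p<p+q (½ * h) (0<½* 0<h)))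
    0<β′+ε = 1≤x⇒0<x+ε {β′} {ε} 1≤β′ 0<ε
    q₀ = proj₁ (admissible ε 0<ε)
    B = proj₁ (bounded β)
    G = power-gap {B} {h} C (proj₁ (proj₂ (bounded β))) 0<h
    gap : ∀ a {b} → a + η < b → (a + h) + h ≤ b
    gap a {b} lt = subst (_≤ b) (trans (cong (λ t → a + t) (sym (½*+½*≡ η))) (sym (+-assoc a h h))) (<⇒≤ lt)
    go : ¬ (∃[ p ] ∃[ q ] Σ[ q≢0 ∈ NonZero q ] (q₀ ℕ.⊔ proj₁ G ℕ.≤ q ×
      Eventually λ k → ∣ seq τ k - _/_ p q {{q≢0}} ∣ * seq β k ^ q ≤ fromℕ C))
    go (p , q , q≢0 , q≥ , near-pq) = clash q (proj₁ P) (<-trans (proj₁ P) (<-≤-trans (p<p+q _ 0<h) (gap (seq β′ (proj₁ K)) (proj₁ (proj₂ P)))))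
        (proj₁ (proj₂ F)) (proj₂ G q (ℕₚ.m⊔n≤o⇒n≤o q₀ (proj₁ G) q≥) (proj₁ P) (gap (seq β′ (proj₁ K)) (proj₁ (proj₂ P)))
          (≤-trans (p≤∣p∣ _) (proj₁ (proj₂ (proj₂ P)))))
        (proj₁ (proj₂ (proj₂ (proj₂ P)))) (proj₂ (proj₂ (proj₂ (proj₂ P))))
      where
      F : Far τ (β′ +ᴿ ε) p q {{q≢0}}
      F = <ᴿ⇒far {τ} {β′ +ᴿ ε} 0<β′+ε p q {{q≢0}}
            (proj₂ (proj₂ (admissible ε 0<ε)) p q {{q≢0}} (ℕₚ.m⊔n≤o⇒m≤o q₀ (proj₁ G) q≥))
      K = eventually⇒∃ {λ k → 0ℚ < seq β′ k + h × seq β′ k + η < seq β k × ∣ seq β k ∣ ≤ B ×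
             ∣ seq τ k - _/_ p q {{q≢0}} ∣ * seq β k ^ q ≤ fromℕ C ×
             inv ((seq β′ k + h) ^ q) + proj₁ F < ∣ seq τ k - _/_ p q {{q≢0}} ∣}
        (eventually-0< {β′ +ᴿ ε} 0<β′+ε ∩ β′+η<β ∩ proj₂ (proj₂ (bounded β)) ∩ near-pq ∩ proj₂ (proj₂ F))
      P = proj₂ K

-- Lacunary series in a rational number

module Series (a b : ℕ) .{{_ : NonZero a}} .{{_ : NonZero b}} (a<b : a ℕ.< b)
  (E : ℕ → ℕ) (E-< : ∀ n → E n ℕ.< E (suc n)) where

  w : ℚ
  w = + a / b

  -- The index shift makes `E n` the top exponent in `S n` for `n ≥ 1`, so that `Q n` clears its
  -- denominators.
  x : ℕ → ℚ
  x n = w ^ E (suc n)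

  S : ℕ → ℚ
  S zero    = 0ℚ
  S (suc n) = S n + x n

  Q : ℕ → ℕ
  Q n = b ℕ.^ E n

  -- Ties each term to the preceding denominator, `x n` being `β^(-Q n)` up to a factor 4; the
  -- factor leaves room for rounding `β^(Q n)` to a power of 2.
  Calibrated : ℝ → Set
  Calibrated β = ∀ n → Eventually λ k → 1ℚ ≤ x n * seq β k ^ Q n × x n * seq β k ^ Q n ≤ fromℕ 4

  -- The numerator of `S n` over the common denominator `Q n`.
  numerator : ℕ → ℕ
  numerator zero    = 0
  numerator (suc n) = numerator n ℕ.* b ℕ.^ (E (suc n) ℕ.∸ E n) ℕ.+ a ℕ.^ E (suc n)

  instance
    Q≢0 : ∀ {n} → NonZero (Q n)
    Q≢0 {n} = ℕₚ.m^n≢0 b (E n)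

  0<b = 0<fromℕ b

  w*b≡a : w * fromℕ b ≡ fromℕ a
  w*b≡a = /-*-cancel (+ a) b

  w^n*b^n≡a^n : ∀ n → w ^ n * fromℕ (b ℕ.^ n) ≡ fromℕ (a ℕ.^ n)
  w^n*b^n≡a^n n = trans (cong (w ^ n *_) (fromℕ-^ b n)) (trans (sym (^-distrib-* w (fromℕ b) n))
    (trans (cong (_^ n) w*b≡a) (sym (fromℕ-^ a n))))

  0<w : 0ℚ < w
  0<w = *-cancelʳ-<-nonNeg (fromℕ b) {{nonNegative (<⇒≤ 0<b)}}
    (subst₂ _<_ (sym (*-zeroˡ (fromℕ b))) (sym w*b≡a) (0<fromℕ a))

  w≤1 : w ≤ 1ℚ
  w≤1 = *-cancelʳ-≤′ (fromℕ b) 0<b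
    (subst₂ _≤_ (sym w*b≡a) (sym (*-identityˡ (fromℕ b))) (fromℕ-mono-≤ (ℕₚ.<⇒≤ a<b)))

  0<x : ∀ n → 0ℚ < x n
  0<x n = 0<^ (E (suc n)) 0<w

  1<b : 1 ℕ.< b
  1<b = ℕₚ.≤-<-trans (ℕ.>-nonZero⁻¹ a) a<b

  n≤E : ∀ n → n ℕ.≤ E n
  n≤E zero    = z≤n
  n≤E (suc n) = ℕₚ.≤-trans (s≤s (n≤E n)) (E-< n)

  n≤Q : ∀ n → n ℕ.≤ Q n
  n≤Q n = ℕₚ.≤-trans (n≤E n) (ℕₚ.<⇒≤ (n<b^n b 1<b (E n)))

  b^E-step : ∀ n → b ℕ.^ E (suc n) ≡ b ℕ.^ E n ℕ.* b ℕ.^ (E (suc n) ℕ.∸ E n)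
  b^E-step n = trans (cong (b ℕ.^_) (sym (ℕₚ.m+[n∸m]≡n (ℕₚ.<⇒≤ (E-< n))))) (ℕₚ.^-distribˡ-+-* b (E n) _)

  S*Q≡numerator : ∀ n → S n * fromℕ (Q n) ≡ fromℕ (numerator n)
  S*Q≡numerator zero    = trans (*-zeroˡ (fromℕ (Q 0))) (sym fromℕ-0)
  S*Q≡numerator (suc n) = trans (*-distribʳ-+ (fromℕ (Q (suc n))) (S n) (x n))
    (trans (cong₂ _+_
      (trans (cong (λ t → S n * fromℕ t) (b^E-step n))
        (trans (cong (S n *_) (fromℕ-* (Q n) d)) (trans (sym (*-assoc (S n) (fromℕ (Q n)) (fromℕ d)))
          (trans (cong (_* fromℕ d) (S*Q≡numerator n)) (sym (fromℕ-* (numerator n) d))))))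
      (w^n*b^n≡a^n (E (suc n))))
      (sym (fromℕ-+ (numerator n ℕ.* d) (a ℕ.^ E (suc n)))))
    where d = b ℕ.^ (E (suc n) ℕ.∸ E n)

  -- As `E n < E (suc n)`, the older terms contribute a multiple of `b`, while the new one
  -- contributes a power of `a`, coprime to `b`.
  coprime-Q-numerator : Coprime b a → ∀ n → Coprime (Q (suc n)) (numerator (suc n))
  coprime-Q-numerator c n = coprime-^ˡ {b} {numerator (suc n)} (subst (λ t → Coprime b (t ℕ.+ a ℕ.^ E (suc n))) (sym split)
      (coprime-*+ {b} {a ℕ.^ E (suc n)} (numerator n ℕ.* b ℕ.^ e)
        (coprime-sym {a ℕ.^ E (suc n)} {b} (coprime-^ˡ {a} {b} (coprime-sym {b} {a} c) (E (suc n))))))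
      (E (suc n))
    where
    e = E (suc n) ℕ.∸ suc (E n)
    split : numerator n ℕ.* b ℕ.^ (E (suc n) ℕ.∸ E n) ≡ numerator n ℕ.* b ℕ.^ e ℕ.* b
    split = trans (cong (λ t → numerator n ℕ.* b ℕ.^ t) (ℕₚ.+-∸-assoc 1 (E-< n)))
      (trans (cong (numerator n ℕ.*_) (ℕₚ.*-comm b (b ℕ.^ e))) (sym (ℕₚ.*-assoc (numerator n) (b ℕ.^ e) b)))

  S-mono : ∀ {n k} → n ℕ.≤ k → S n ≤ S k
  S-mono {n} {k} n≤k = subst (λ t → S n ≤ S t) (ℕₚ.m∸n+n≡m n≤k) (go (k ℕ.∸ n))
    where
    go : ∀ d → S n ≤ S (d ℕ.+ n)
    go zero    = ≤-refl
    go (suc d) = ≤-trans (go d) (<⇒≤ (p<p+q (S (d ℕ.+ n)) (0<x (d ℕ.+ n))))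

  -- S n + b x n is decreasing because x (n + 1) ≤ w x n and b w + 1 = a + 1 ≤ b.
  S-upper : ∀ {n k} → n ℕ.≤ k → S k ≤ S n + fromℕ b * x n
  S-upper {n} {k} n≤k = ≤-trans (<⇒≤ (p<p+q (S k) (0<* 0<b (0<x k))))
    (subst (λ t → S t + fromℕ b * x t ≤ S n + fromℕ b * x n) (ℕₚ.m∸n+n≡m n≤k) (go (k ℕ.∸ n)))
    where
    step : ∀ n → x n + fromℕ b * x (suc n) ≤ fromℕ b * x n
    step n = ≤-trans (+-monoʳ-≤ (x n) (≤-trans
        (*-monoʳ-≤′ (fromℕ b) (<⇒≤ 0<b) (^-antimonoʳ-≤ 0<w w≤1 (E-< (suc n))))
        (≤-reflexive (trans (sym (*-assoc (fromℕ b) w (x n))) (cong (_* x n) (trans (*-comm (fromℕ b) w) w*b≡a))))))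
      (subst (_≤ fromℕ b * x n)
        (trans (cong (_* x n) (fromℕ-suc a)) (trans (*-distribʳ-+ (x n) 1ℚ (fromℕ a)) (cong (_+ fromℕ a * x n) (*-identityˡ (x n)))))
        (*-monoˡ-≤′ (x n) (<⇒≤ (0<x n)) (fromℕ-mono-≤ a<b)))
    go : ∀ d → S (d ℕ.+ n) + fromℕ b * x (d ℕ.+ n) ≤ S n + fromℕ b * x n
    go zero    = ≤-refl
    go (suc d) = ≤-trans (subst (_≤ S (d ℕ.+ n) + fromℕ b * x (d ℕ.+ n))
      (sym (+-assoc (S (d ℕ.+ n)) (x (d ℕ.+ n)) (fromℕ b * x (suc (d ℕ.+ n)))))
      (+-monoʳ-≤ (S (d ℕ.+ n)) (step (d ℕ.+ n)))) (go d)

  ∣S-S∣≤ : ∀ {n k} → n ℕ.≤ k → ∣ S k - S n ∣ ≤ fromℕ b * x n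
  ∣S-S∣≤ {n} {k} n≤k = subst₂ _≤_ (sym (0≤p⇒∣p∣≡p (≤⇒0≤- (S-mono n≤k))))
    (ℚS.solve 2 (λ s t → (s :+ t) :- s := t) refl (S n) (fromℕ b * x n))
    (+-monoˡ-≤ (- S n) (S-upper n≤k))
    where open ℚS

  -- Writing `b = m + 1` gives `a ≤ m`, so `w ^ q` is at most `(m / (m + 1)) ^ q` and degree 0 of
  -- `polynomial≤exponential` applies.
  C*w^q≤1 : ∀ C → ∃[ q₀ ] (∀ q → q₀ ℕ.≤ q → fromℕ C * w ^ q ≤ 1ℚ)
  C*w^q≤1 C = go b a<b
    where
    go : ∀ b′ → a ℕ.< b′ → {{b ≡ b′}} → ∃[ q₀ ] (∀ q → q₀ ℕ.≤ q → fromℕ C * w ^ q ≤ 1ℚ)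
    go (suc m) (s≤s a≤m) {{refl}} = proj₁ P , λ q q≥ → *-cancelʳ-≤′ (fromℕ (b ℕ.^ q)) (0<fromℕ (b ℕ.^ q) {{ℕₚ.m^n≢0 b q}})
      (subst₂ _≤_
        (trans (fromℕ-* C (a ℕ.^ q)) (trans (cong (fromℕ C *_) (sym (w^n*b^n≡a^n q))) (sym (*-assoc (fromℕ C) (w ^ q) (fromℕ (b ℕ.^ q))))))
        (sym (*-identityˡ (fromℕ (b ℕ.^ q))))
        (fromℕ-mono-≤ (ℕₚ.≤-trans (ℕₚ.*-mono-≤ (ℕₚ.≤-reflexive (sym (ℕₚ.*-identityʳ C))) (ℕₚ.^-monoˡ-≤ q a≤m)) (proj₂ P q q≥))))
      where
      P = polynomial≤exponential 0 C m {{ℕ.>-nonZero (ℕₚ.≤-trans (ℕ.>-nonZero⁻¹ a) a≤m)}}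

  tail-small : ∀ ε → 0ℚ < ε → ∃[ N ] (∀ n → N ℕ.≤ n → fromℕ b * x n < ε)
  tail-small ε 0<ε = proj₁ P , λ n n≥ → ≤-<-trans
    (*-monoʳ-≤′ (fromℕ b) (<⇒≤ 0<b) (^-antimonoʳ-≤ 0<w w≤1 (ℕₚ.≤-trans (ℕₚ.n≤1+n n) (n≤E (suc n)))))
    (<-≤-trans (small n)
      (subst (fromℕ C * w ^ n * ε ≤_) (*-identityˡ ε) (*-monoˡ-≤′ ε (<⇒≤ 0<ε) (proj₂ P n n≥))))
    where
    -- With `C > b / ε`, the bound `C * w ^ n ≤ 1` yields `b * w ^ n < ε`.
    A = archimedean (fromℕ b * inv ε)
    C = proj₁ A
    P = C*w^q≤1 C
    b<Cε : fromℕ b < fromℕ C * ε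
    b<Cε = subst (_< fromℕ C * ε)
      (trans (*-assoc (fromℕ b) (inv ε) ε) (trans (cong (fromℕ b *_) (trans (*-comm (inv ε) ε) (*-inv 0<ε))) (*-identityʳ (fromℕ b))))
      (*-monoˡ-<-pos ε {{positive 0<ε}} (proj₂ A))
    small : ∀ n → fromℕ b * w ^ n < fromℕ C * w ^ n * ε
    small n = subst (fromℕ b * w ^ n <_) (ℚS.solve 3 (λ c e v → (c :* e) :* v := (c :* v) :* e) refl (fromℕ C) ε (w ^ n))
      (*-monoˡ-<-pos (w ^ n) {{positive (0<^ n 0<w)}} b<Cε)
      where open ℚS

  S-cauchy : Cauchy S
  S-cauchy ε 0<ε = N , λ m n m≥ n≥ → ordered m n m≥ n≥ (ℕₚ.≤-total n m)
    where
    N = proj₁ (tail-small ε 0<ε)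
    ordered : ∀ m n → N ℕ.≤ m → N ℕ.≤ n → n ℕ.≤ m ⊎ m ℕ.≤ n → ∣ S m - S n ∣ < ε
    ordered m n m≥ n≥ (inj₁ n≤m) = ≤-<-trans (∣S-S∣≤ n≤m) (proj₂ (tail-small ε 0<ε) n n≥)
    ordered m n m≥ n≥ (inj₂ m≤n) = subst (_< ε) (∣p-q∣≡∣q-p∣ (S n) (S m))
      (≤-<-trans (∣S-S∣≤ m≤n) (proj₂ (tail-small ε 0<ε) m m≥))

  τ : ℝ
  τ = mkℝ S S-cauchy

  -- The terms are constant sequences, so at an index `k ≥ n` the partial sum and `τ` differ by
  -- `S n - S k`, a piece of the tail.
  hasSum : ∀ {f} → (∀ n k → seq (f n) k ≡ x n) → HasSum f τ
  hasSum {f} f≡x ε 0<ε =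
    proj₁ T , λ n n≥ → ½ * δ , 0<½* 0<δ , eventually-map
      (λ k (n≤k , δ<ε) → <-trans (subst₂ _<_
          (cong (λ t → ∣ t - S k ∣ + ½ * δ) (sym (partial n k))) (½*+½*≡ δ)
          (+-monoˡ-< (½ * δ) (subst (_< ½ * δ) (∣p-q∣≡∣q-p∣ (S k) (S n)) (≤-<-trans (∣S-S∣≤ n≤k) (proj₂ T n n≥)))))
        δ<ε)
      ((n , λ _ n≤k → n≤k) ∩ proj₂ (proj₂ A))
    where
    A = 0<ᴿ⇒away {ε} 0<ε
    δ = proj₁ A
    0<δ = proj₁ (proj₂ A)
    T = tail-small (½ * δ) (0<½* 0<δ)
    partial : ∀ n k → seq (partialSum f n) k ≡ S n
    partial zero    k = refl
    partial (suc n) k = cong₂ _+_ (partial n k) (f≡x n k)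

  -- Lowest terms: `Q (suc n)` divides `numerator (suc n) * q` and is coprime to the first factor,
  -- hence divides `q`.
  Q≤denominator : Coprime b a → ∀ n p q .{{_ : NonZero q}} →
    p ℤ.* + Q (suc n) ≡ + numerator (suc n) ℤ.* + q → Q (suc n) ℕ.≤ q
  Q≤denominator c n p q e = ℕᵈ.∣⇒≤ (coprime-divisor {Q (suc n)} {numerator (suc n)} {q} (coprime-Q-numerator c n)
    (ℕᵈ.divides ℤ.∣ p ∣ (trans (sym (ℤₚ.abs-* (+ numerator (suc n)) (+ q)))
      (trans (cong ℤ.∣_∣ (sym e)) (ℤₚ.abs-* p (+ Q (suc n)))))))

  -- Triangle inequality: of the separation `1 / (q * Q j)` between `p / q` and `S j`, the tail
  -- after `S j` takes at most half.
  far-from-S : ∀ j k p q .{{_ : NonZero q}} → j ℕ.≤ k →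
    1ℚ ≤ ∣ p / q - S j ∣ * (fromℕ q * fromℕ (Q j)) →
    fromℕ (2 ℕ.* (q ℕ.* Q j)) * (fromℕ b * x j) ≤ 1ℚ →
    1ℚ ≤ ∣ S k - p / q ∣ * fromℕ (2 ℕ.* (q ℕ.* Q j))
  far-from-S j k p q j≤k 1≤ small = subst₂ _≤_ (p+q-q≡p 1ℚ 1ℚ) (p+q-q≡p (d * c) 1ℚ)
    (+-monoˡ-≤ (- 1ℚ) (≤-trans 2≤ (+-monoʳ-≤ (d * c) small)))
    where
    open ℚS
    d = ∣ S k - p / q ∣
    c = fromℕ (2 ℕ.* (q ℕ.* Q j))
    g = fromℕ q * fromℕ (Q j)
    t = fromℕ b * x j
    p+q-q≡p : ∀ p q → p + q - q ≡ p
    p+q-q≡p = solve 2 (λ p q → p :+ q :- q := p) refl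
    2≡ : fromℕ 2 ≡ 1ℚ + 1ℚ
    2≡ = trans (fromℕ-suc 1) (cong (λ t → 1ℚ + t) fromℕ-1)
    c≡ : c ≡ (1ℚ + 1ℚ) * g
    c≡ = trans (fromℕ-* 2 (q ℕ.* Q j)) (cong₂ _*_ 2≡ (fromℕ-* q (Q j)))
    triangle : ∣ p / q - S j ∣ ≤ d + t
    triangle = ≤-trans
      (subst₂ (λ u v → ∣ u ∣ ≤ v + ∣ S k - S j ∣)
        (solve 3 (λ r s u → (r :- s) :+ (s :- u) := r :- u) refl (p / q) (S k) (S j))
        (∣p-q∣≡∣q-p∣ (p / q) (S k)) (∣p+q∣≤∣p∣+∣q∣ (p / q - S k) (S k - S j)))
      (+-monoʳ-≤ d (∣S-S∣≤ j≤k))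
    1≤dg+tg : 1ℚ ≤ (d + t) * g
    1≤dg+tg = ≤-trans 1≤ (*-monoˡ-≤′ g (0≤* (0≤fromℕ q) (0≤fromℕ (Q j))) triangle)
    2≤ : 1ℚ + 1ℚ ≤ d * c + c * t
    2≤ = subst (1ℚ + 1ℚ ≤_)
      (trans (solve 3 (λ d t g → (d :+ t) :* g :+ (d :+ t) :* g
                := d :* (g :+ g) :+ (g :+ g) :* t) refl d t g)
        (cong (λ c → d * c + c * t) (sym (trans c≡ (trans (*-distribʳ-+ g 1ℚ 1ℚ) (cong₂ _+_ (*-identityˡ g) (*-identityˡ g)))))))
      (+-mono-≤ 1≤dg+tg 1≤dg+tg)

-- Lower bounds for the distance from the series to rationals

ℕ-^-distrib-* : ∀ m n k → (m ℕ.* n) ℕ.^ k ≡ m ℕ.^ k ℕ.* n ℕ.^ k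
ℕ-^-distrib-* m n zero    = refl
ℕ-^-distrib-* m n (suc k) = trans (cong (m ℕ.* n ℕ.*_) (ℕ-^-distrib-* m n k))
  (solve 4 (λ m n u v → m :* n :* (u :* v) := (m :* u) :* (n :* v)) refl m n (m ℕ.^ k) (n ℕ.^ k))
  where open ℕS

-- Of the three thirds of `1 / D`, one will dominate `β^(-q)`, one is the margin in `Far`, and the
-- last gives strictness.
1≤d*D⇒2/3D<d : ∀ D .{{_ : NonZero D}} d → 1ℚ ≤ d * fromℕ D → inv (fromℕ (3 ℕ.* D)) + inv (fromℕ (3 ℕ.* D)) < d
1≤d*D⇒2/3D<d D d 1≤dD = *-cancelʳ-<-nonNeg T {{nonNegative (0≤fromℕ (3 ℕ.* D))}}
  (<-≤-trans (subst₂ _<_ (sym (trans (*-distribʳ-+ T i i) (cong₂ _+_ iT iT))) (sym (fromℕ-* 3 1))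
      (subst (1ℚ + 1ℚ <_) (sym three) (p<q+p (1ℚ + 1ℚ) 0<1ℚ)))
    (subst₂ _≤_ (sym (trans (fromℕ-* 3 1) (cong (fromℕ 3 *_) fromℕ-1)))
      (trans (solve 3 (λ t d D → t :* (d :* D) := d :* (t :* D)) refl (fromℕ 3) d (fromℕ D)) (cong (d *_) (sym (fromℕ-* 3 D))))
      (*-monoʳ-≤′ (fromℕ 3) (0≤fromℕ 3) 1≤dD)))
  where
  open ℚS
  T = fromℕ (3 ℕ.* D)
  i = inv T
  iT : i * T ≡ 1ℚ
  iT = trans (*-comm i T) (*-inv (0<fromℕ (3 ℕ.* D) {{ℕₚ.m*n≢0 3 D}}))
  three : fromℕ 3 * fromℕ 1 ≡ 1ℚ + (1ℚ + 1ℚ)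
  three = trans (cong (fromℕ 3 *_) fromℕ-1) (trans (*-identityʳ (fromℕ 3))
    (trans (fromℕ-suc 2) (cong (λ t → 1ℚ + t) (trans (fromℕ-suc 1) (cong (λ t → 1ℚ + t) fromℕ-1)))))

Conclusion : (β τ : ℝ) → 1ᴿ <ᴿ β → Set
Conclusion β τ 1<β = let 0<β = 1<x⇒0<x {β} 1<β in
  Irrational τ
  × IrrationalityBase τ β
  × ¬ Approximable τ (λ q → 1/ β ^ q ⟨ 0<β ⟩)
  × EventuallyFarFromRationals τ β 0<β

module Construction (a b : ℕ) .{{_ : NonZero a}} .{{_ : NonZero b}} (a<b : a ℕ.< b) (b⊥a : Coprime b a)
  (E : ℕ → ℕ) (E-< : ∀ n → E n ℕ.< E (suc n)) (β : ℝ) (1<β : 1ᴿ <ᴿ β)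
  (scale : Series.Calibrated a b a<b E E-< β) where

  open Series a b a<b E E-<

  0<β = 1<x⇒0<x {β} 1<β

  private
    c = proj₁ 1<β
    G = 1<⇒[m+1]/m≤ c (proj₁ (proj₂ 1<β))

  m = proj₁ G

  instance
    m≢0 : NonZero m
    m≢0 = proj₁ (proj₂ G)

  β-bound : Eventually λ k → fromℕ (suc m) ≤ seq β k * fromℕ m
  β-bound = eventually-map (λ k lt → proj₂ (proj₂ G) (seq β k) (<⇒≤ lt)) (proj₂ (proj₂ 1<β))

  1≤β : Eventually λ k → 1ℚ ≤ seq β k
  1≤β = eventually-map (λ k lt → ≤-trans (<⇒≤ (p<p+q 1ℚ (proj₁ (proj₂ 1<β)))) (<⇒≤ lt)) (proj₂ (proj₂ 1<β))

  -- Calibration gives `x n ≤ 4 β^(-Q n)`, and `β^(Q n)` outgrows any polynomial in `Q n`.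
  x-superpolynomial : ∃[ n₀ ] (∀ n → n₀ ℕ.≤ n → fromℕ (2 ℕ.* (Q n ℕ.* Q n)) * (fromℕ b * x n) ≤ 1ℚ)
  x-superpolynomial = proj₁ P , λ n n≥ → small n (proj₂ P (Q n) (ℕₚ.≤-trans n≥ (n≤Q n)))
    where
    -- The constant `8 * b` collects the 2 and the `b` of the goal and the 4 of the calibration.
    P = polynomial≤exponential 2 (8 ℕ.* b) m
    small : ∀ n → 8 ℕ.* b ℕ.* Q n ℕ.^ 2 ℕ.* m ℕ.^ Q n ℕ.≤ suc m ℕ.^ Q n →
      fromℕ (2 ℕ.* (Q n ℕ.* Q n)) * (fromℕ b * x n) ≤ 1ℚ
    small n P≤ = *-cancelʳ-≤′ (fromℕ 4) (0<fromℕ 4) (≤-trans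
      (subst (_≤ x n * z) eq (*-monoʳ-≤′ (x n) (<⇒≤ (0<x n)) D≤z))
      (subst (x n * z ≤_) (sym (*-identityˡ (fromℕ 4))) (proj₂ (proj₁ (proj₂ K)))))
      where
      K = eventually⇒∃ {λ k → (1ℚ ≤ x n * seq β k ^ Q n × x n * seq β k ^ Q n ≤ fromℕ 4) × fromℕ (suc m) ≤ seq β k * fromℕ m}
        (scale n ∩ β-bound)
      z = seq β (proj₁ K) ^ Q n
      D≤z : fromℕ (8 ℕ.* b ℕ.* Q n ℕ.^ 2) ≤ z
      D≤z = ^-lower-bound m (8 ℕ.* b ℕ.* Q n ℕ.^ 2) (Q n) (proj₂ (proj₂ K)) P≤ ≤-refl
      8bQ²≡ : 8 ℕ.* b ℕ.* Q n ℕ.^ 2 ≡ 2 ℕ.* (Q n ℕ.* Q n) ℕ.* b ℕ.* 4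
      8bQ²≡ = solve 2 (λ b Q → con 8 :* b :* (Q :* (Q :* con 1)) := con 2 :* (Q :* Q) :* b :* con 4) refl b (Q n)
        where open ℕS
      eq : x n * fromℕ (8 ℕ.* b ℕ.* Q n ℕ.^ 2) ≡ fromℕ (2 ℕ.* (Q n ℕ.* Q n)) * (fromℕ b * x n) * fromℕ 4
      eq = trans (cong (λ t → x n * fromℕ t)
          8bQ²≡)
        (trans (cong (x n *_) (trans (fromℕ-* (2 ℕ.* (Q n ℕ.* Q n) ℕ.* b) 4)
            (cong (_* fromℕ 4) (fromℕ-* (2 ℕ.* (Q n ℕ.* Q n)) b))))
          (solve 4 (λ x u b f → x :* (u :* b :* f) := u :* (b :* x) :* f) refl (x n) (fromℕ (2 ℕ.* (Q n ℕ.* Q n))) (fromℕ b) (fromℕ 4)))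
        where open ℚS

  -- Chosen with `b * w ^ K ≤ 1`: the base `b` of the denominators is at most the `K`-th power of
  -- `1 / w`.
  K : ℕ
  K = proj₁ (C*w^q≤1 b)

  -- The power of `2 b q²` bounds `Q (suc n)` in `Q≤M`; the extra factor `q` gives `q ≤ M q`, so one
  -- bound serves both approximants.
  M : ℕ → ℕ
  M q = q ℕ.* (2 ℕ.* b ℕ.* (q ℕ.* q)) ℕ.^ K

  q≤M : ∀ q .{{_ : NonZero q}} → q ℕ.≤ M q
  q≤M q = ℕₚ.m≤m*n q _ {{ℕₚ.m^n≢0 (2 ℕ.* b ℕ.* (q ℕ.* q)) K
    {{ℕₚ.m*n≢0 (2 ℕ.* b) (q ℕ.* q) {{ℕₚ.m*n≢0 2 b}} {{ℕₚ.m*n≢0 q q}}}}}}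

  Q*x^K≤1 : ∀ n → fromℕ (Q (suc n)) * x n ^ K ≤ 1ℚ
  Q*x^K≤1 n = subst (_≤ 1ℚ) eq (^≤1 e (0<* 0<b (0<^ K 0<w)) (proj₂ (C*w^q≤1 b) K ℕₚ.≤-refl))
    where
    e = E (suc n)
    eq : (fromℕ b * w ^ K) ^ e ≡ fromℕ (Q (suc n)) * x n ^ K
    eq = trans (^-distrib-* (fromℕ b) (w ^ K) e) (cong₂ _*_ (sym (fromℕ-^ b e))
      (trans (^-assocʳ w K e) (trans (cong (w ^_) (ℕₚ.*-comm K e)) (sym (^-assocʳ w e K)))))

  -- A tail that is not small means `x n ≥ 1 / (2 b q²)`, and `Q (suc n)` is at most the `K`-th
  -- power of `1 / x n`.
  Q≤M : ∀ n q .{{_ : NonZero q}} → Q n ℕ.≤ q → 1ℚ ≤ fromℕ (2 ℕ.* (q ℕ.* Q n)) * (fromℕ b * x n) → Q (suc n) ℕ.≤ M q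
  Q≤M n q Qn≤q 1≤ = ℕₚ.≤-trans (fromℕ-cancel-≤ {Q (suc n)} {y ℕ.^ K} Q≤y^K) (ℕₚ.m≤n*m (y ℕ.^ K) q)
    where
    y = 2 ℕ.* b ℕ.* (q ℕ.* q)
    1≤yx : 1ℚ ≤ fromℕ y * x n
    1≤yx = ≤-trans 1≤ (subst (_≤ fromℕ y * x n)
      (trans (cong (_* x n) (fromℕ-* (2 ℕ.* (q ℕ.* Q n)) b)) (*-assoc (fromℕ (2 ℕ.* (q ℕ.* Q n))) (fromℕ b) (x n)))
      (*-monoˡ-≤′ (x n) (<⇒≤ (0<x n)) (fromℕ-mono-≤ (ℕₚ.≤-trans
        (ℕₚ.*-monoˡ-≤ b (ℕₚ.*-monoʳ-≤ 2 (ℕₚ.*-monoʳ-≤ q Qn≤q)))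
        (ℕₚ.≤-reflexive (ℕS.solve 2 (λ b q → con 2 :* (q :* q) :* b := con 2 :* b :* (q :* q)) refl b q))))))
      where open ℕS
    Q≤y^K : fromℕ (Q (suc n)) ≤ fromℕ (y ℕ.^ K)
    Q≤y^K = *-cancelʳ-≤′ (x n ^ K) (0<^ K (0<x n)) (≤-trans (Q*x^K≤1 n)
      (subst (1ℚ ≤_) (trans (^-distrib-* (fromℕ y) (x n) K) (cong (_* x n ^ K) (sym (fromℕ-^ y K)))) (1≤^ K 1≤yx)))

  3*D : ∀ q → (6 ℕ.* (2 ℕ.* b) ℕ.^ K) ℕ.* q ℕ.^ (2 ℕ.+ 2 ℕ.* K) ≡ 3 ℕ.* (2 ℕ.* (q ℕ.* M q))
  3*D q = trans
    (solve 3 (λ u q v → (con 6 :* u) :* (q :* (q :* v)) := con 3 :* (con 2 :* (q :* (q :* (u :* v))))) refl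
      ((2 ℕ.* b) ℕ.^ K) q (q ℕ.^ (2 ℕ.* K)))
    (cong (λ t → 3 ℕ.* (2 ℕ.* (q ℕ.* (q ℕ.* t)))) (sym (trans (ℕ-^-distrib-* (2 ℕ.* b) (q ℕ.* q) K)
      (cong ((2 ℕ.* b) ℕ.^ K ℕ.*_) (trans (cong (ℕ._^ K) (cong (q ℕ.*_) (sym (ℕₚ.*-identityʳ q)))) (ℕₚ.^-*-assoc q 2 K))))))
    where open ℕS

  private
    R = polynomial≤exponential (2 ℕ.+ 2 ℕ.* K) (6 ℕ.* (2 ℕ.* b) ℕ.^ K) m
    n₀ = proj₁ x-superpolynomial

  -- The distance is at least `1 / D` with `D` polynomial in `q`. Past the threshold in `R`,
  -- `β^q ≥ 3 D`, so `β^(-q)` and `ε` each take at most a third.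
  far-from-approximant : ∀ j p q .{{_ : NonZero q}} → proj₁ R ℕ.≤ q → Q j ℕ.≤ M q →
    1ℚ ≤ ∣ p / q - S j ∣ * (fromℕ q * fromℕ (Q j)) →
    fromℕ (2 ℕ.* (q ℕ.* Q j)) * (fromℕ b * x j) ≤ 1ℚ → Far τ β p q
  far-from-approximant j p q {{q≢0}} q≥ Q≤ separated small = ε , 0<inv 0<T , eventually-map
    (λ k (j≤k , bound) → ≤-<-trans (+-monoˡ-≤ ε (inv-antimono-≤ 0<T (T≤β^q bound)))
      (1≤d*D⇒2/3D<d D {{D≢0}} ∣ S k - p / q ∣ (≤-trans (far-from-S j k p q j≤k separated small)
        (*-monoʳ-≤′ ∣ S k - p / q ∣ (0≤∣p∣ (S k - p / q)) (fromℕ-mono-≤ (ℕₚ.*-monoʳ-≤ 2 (ℕₚ.*-monoʳ-≤ q Q≤)))))))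
    ((j , λ _ j≤k → j≤k) ∩ β-bound)
    where
    D = 2 ℕ.* (q ℕ.* M q)
    ε = inv (fromℕ (3 ℕ.* D))
    D≢0 : NonZero D
    D≢0 = ℕₚ.m*n≢0 2 (q ℕ.* M q) {{_}} {{ℕₚ.m*n≢0 q (M q) {{q≢0}} {{ℕ.>-nonZero (ℕₚ.<-≤-trans (ℕ.>-nonZero⁻¹ q) (q≤M q))}}}}
    0<T : 0ℚ < fromℕ (3 ℕ.* D)
    0<T = 0<fromℕ (3 ℕ.* D) {{ℕₚ.m*n≢0 3 D {{_}} {{D≢0}}}}
    T≤β^q : ∀ {k} → fromℕ (suc m) ≤ seq β k * fromℕ m → fromℕ (3 ℕ.* D) ≤ seq β k ^ q
    T≤β^q bound = ^-lower-bound m (3 ℕ.* D) q bound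
      (subst (λ t → t ℕ.* m ℕ.^ q ℕ.≤ suc m ℕ.^ q) (3*D q) (proj₂ R q q≥)) ≤-refl

  -- The tail beyond `S n` contains `x n ≥ β^(-Q n) ≥ β^(-q)` and also `x (suc n)`, half of which is
  -- the strict margin.
  far-at-approximant : ∀ n p q .{{_ : NonZero q}} → Q n ℕ.≤ q → p / q ≡ S n → Far τ β p q
  far-at-approximant n p q Q≤q p/q≡S = ½ * y , 0<½* (0<x (suc n)) , eventually-map
    (λ k (n+2≤k , 1≤b , (1≤xb , _)) → <-≤-trans
      (≤-<-trans (+-monoˡ-≤ (½ * y) (≤-trans (inv-antimono-≤ (0<^ (Q n) (<-≤-trans 0<1ℚ 1≤b)) (^-monoʳ-≤ 1≤b Q≤q))
          (inv≤ {c = x n} (0<^ (Q n) (<-≤-trans 0<1ℚ 1≤b)) 1≤xb)))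
        (+-monoʳ-< (x n) (subst (½ * y <_) (½*+½*≡ y) (p<p+q (½ * y) (0<½* (0<x (suc n)))))))
      (distance n+2≤k))
    ((suc (suc n) , λ _ n+2≤k → n+2≤k) ∩ 1≤β ∩ scale n)
    where
    open ℚS
    y = x (suc n)
    distance : ∀ {k} → suc (suc n) ℕ.≤ k → x n + y ≤ ∣ S k - p / q ∣
    distance {k} n+2≤k = subst (λ r → x n + y ≤ ∣ S k - r ∣) (sym p/q≡S)
      (≤-trans (subst (_≤ S k - S n) (solve 3 (λ s x y → ((s :+ x) :+ y) :- s := x :+ y) refl (S n) (x n) y)
        (+-monoˡ-≤ (- S n) (S-mono n+2≤k))) (p≤∣p∣ (S k - S n)))

  p/q≡S : ∀ n p q .{{_ : NonZero q}} → p ℤ.* + Q n ≡ + numerator n ℤ.* + q → p / q ≡ S n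
  p/q≡S n p q e = ≤-antisym (cancel (≤-reflexive eq)) (cancel (≤-reflexive (sym eq)))
    where
    cancel : ∀ {r s} → r * fromℕ q * fromℕ (Q n) ≤ s * fromℕ q * fromℕ (Q n) → r ≤ s
    cancel le = *-cancelʳ-≤′ (fromℕ q) (0<fromℕ q) (*-cancelʳ-≤′ (fromℕ (Q n)) (0<fromℕ (Q n) {{Q≢0 {n}}}) le)
    eq : p / q * fromℕ q * fromℕ (Q n) ≡ S n * fromℕ q * fromℕ (Q n)
    eq = trans (cong (_* fromℕ (Q n)) (/-*-cancel p q)) (trans (sym (fromℤ-* p (+ Q n))) (trans (cong fromℤ e)
      (trans (fromℤ-* (+ numerator n) (+ q)) (trans (cong (_* fromℕ q) (sym (S*Q≡numerator n)))
        (solve 3 (λ s u v → s :* u :* v := s :* v :* u) refl (S n) (fromℕ (Q n)) (fromℕ q))))))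
      where open ℚS

  -- If the tail after `S n` is small against `1 / (q * Q n)`, then `p / q` is compared with `S n`,
  -- otherwise with `S (suc n)`.
  far-between : ∀ n p q .{{_ : NonZero q}} → n₀ ℕ.≤ n → proj₁ R ℕ.≤ q → Q n ℕ.≤ q → q ℕ.< Q (suc n) → Far τ β p q
  far-between n p q {{q≢0}} n₀≤n q≥ Qn≤q q<Q = cases (fromℕ (2 ℕ.* (q ℕ.* Q n)) * (fromℕ b * x n) ≤? 1ℚ)
    where
    cases : Dec (fromℕ (2 ℕ.* (q ℕ.* Q n)) * (fromℕ b * x n) ≤ 1ℚ) → Far τ β p q
    cases (yes small) = this (separation {p / q} {S n} {p} {+ numerator n} q (Q n) {{q≢0}} {{Q≢0 {n}}} (/-*-cancel p q) (S*Q≡numerator n))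
      where
      this : p ℤ.* + Q n ≡ + numerator n ℤ.* + q ⊎ 1ℚ ≤ ∣ p / q - S n ∣ * (fromℕ q * fromℕ (Q n)) → Far τ β p q
      this (inj₁ e) = far-at-approximant n p q Qn≤q (p/q≡S n p q e)
      this (inj₂ separated) = far-from-approximant n p q q≥ (ℕₚ.≤-trans Qn≤q (q≤M q)) separated small
    cases (no large) = next (separation {p / q} {S (suc n)} {p} {+ numerator (suc n)} q (Q (suc n)) {{q≢0}} {{Q≢0 {suc n}}}
        (/-*-cancel p q) (S*Q≡numerator (suc n)))
      where
      next : p ℤ.* + Q (suc n) ≡ + numerator (suc n) ℤ.* + q ⊎ 1ℚ ≤ ∣ p / q - S (suc n) ∣ * (fromℕ q * fromℕ (Q (suc n))) → Far τ β p q
      -- Equality with `S (suc n)` would force `Q (suc n) ≤ q`.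
      next (inj₁ e) = contradiction (Q≤denominator b⊥a n p q e) (ℕₚ.<⇒≱ q<Q)
      next (inj₂ separated) = far-from-approximant (suc n) p q q≥ (Q≤M n q Qn≤q (<⇒≤ (≰⇒> large))) separated
        -- Since `q < Q (suc n)`, smallness of this tail follows from `x-superpolynomial`.
        (≤-trans (*-monoˡ-≤′ (fromℕ b * x (suc n)) (<⇒≤ (0<* 0<b (0<x (suc n))))
            (fromℕ-mono-≤ (ℕₚ.*-monoʳ-≤ 2 (ℕₚ.*-monoˡ-≤ (Q (suc n)) (ℕₚ.<⇒≤ q<Q)))))
          (proj₂ x-superpolynomial (suc n) (ℕₚ.≤-trans n₀≤n (ℕₚ.n≤1+n n))))

  eventually-far : EventuallyFarFromRationals τ β 0<β
  eventually-far = Q n₀ ℕ.⊔ proj₁ R , λ p q q≥ → far⇒<ᴿ {τ} {β} 0<β p q (go p q (ℕₚ.m⊔n≤o⇒m≤o (Q n₀) (proj₁ R) q≥) (ℕₚ.m⊔n≤o⇒n≤o (Q n₀) (proj₁ R) q≥))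
    where
    go : ∀ p q .{{_ : NonZero q}} → Q n₀ ℕ.≤ q → proj₁ R ℕ.≤ q → Far τ β p q
    go p q Q≤q R≤q = far-between (proj₁ L) p q (proj₁ (proj₂ L)) R≤q (proj₁ (proj₂ (proj₂ L))) (ℕₚ.≰⇒> (proj₂ (proj₂ (proj₂ L))))
      where
      -- By `n≤Q`, `Q` exceeds `q` at the index `suc q + n₀` from which the search descends.
      L = last-before {λ n → Q n ℕ.≤ q} (λ n → Q n ℕₚ.≤? q) n₀ (suc q) Q≤q
        (ℕₚ.<⇒≱ (ℕₚ.≤-trans (ℕₚ.m≤m+n (suc q) n₀) (n≤Q (suc q ℕ.+ n₀))))

  -- The partial sums serve: `|τ - S N| ≤ b * x N ≤ 4 b β^(-Q N)`, with `Q N ≥ N`.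
  near : InfinitelyOftenNear τ β
  near = b ℕ.* 4 , λ N → + numerator N , Q N , Q≢0 {N} , n≤Q N , eventually-map
    (λ k (N≤k , 1≤β , (_ , xb≤4)) → close N k N≤k (0<^ (Q N) (<-≤-trans 0<1ℚ 1≤β)) xb≤4)
    ((N , λ _ N≤k → N≤k) ∩ 1≤β ∩ scale N)
    where
    close : ∀ N k → N ℕ.≤ k → ∀ {z} → 0ℚ < z → x N * z ≤ fromℕ 4 →
      ∣ S k - _/_ (+ numerator N) (Q N) {{Q≢0 {N}}} ∣ * z ≤ fromℕ (b ℕ.* 4)
    close N k N≤k {z} 0<z xz≤4 = subst (λ r → ∣ S k - r ∣ * z ≤ fromℕ (b ℕ.* 4))
      (sym (p/q≡S N (+ numerator N) (Q N) {{Q≢0 {N}}} refl))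
      (≤-trans (*-monoˡ-≤′ z (<⇒≤ 0<z) (∣S-S∣≤ N≤k))
        (subst₂ _≤_ (sym (*-assoc (fromℕ b) (x N) z)) (sym (fromℕ-* b 4)) (*-monoʳ-≤′ (fromℕ b) (<⇒≤ 0<b) xz≤4)))

  conclusion : Conclusion β τ 1<β
  conclusion = far⇒irrational {τ} {β} 0<β eventually-far
    , far∧near⇒irrationalityBase {τ} {β} 1<β eventually-far near
    , far⇒¬approximable {τ} {β} 0<β eventually-far
    , eventually-far

-- Dyadic exponents for a real base

½^n*2^n≡1 : ∀ n → (+ 1 / 2) ^ n * fromℕ (2 ℕ.^ n) ≡ 1ℚ
½^n*2^n≡1 n = trans (cong ((+ 1 / 2) ^ n *_) (fromℕ-^ 2 n)) (trans (sym (^-distrib-* (+ 1 / 2) (fromℕ 2) n))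
  (trans (cong (_^ n) (trans (/-*-cancel (+ 1) 2) fromℕ-1)) (1^≡1 n)))

½≤1 : ½ ≤ 1ℚ
½≤1 = <⇒≤ (subst (½ <_) (½*+½*≡ 1ℚ) (p<p+q ½ (positive⁻¹ ½)))

between-powers⇒scaled : ∀ e {z} → fromℕ (2 ℕ.^ e) ≤ z → z ≤ fromℕ (2 ℕ.^ e ℕ.* 4) →
  1ℚ ≤ (+ 1 / 2) ^ e * z × (+ 1 / 2) ^ e * z ≤ fromℕ 4
between-powers⇒scaled e {z} t≤z z≤4t =
    subst (_≤ v * z) (½^n*2^n≡1 e) (*-monoʳ-≤′ v 0≤v t≤z)
  , subst (v * z ≤_) (trans (cong (v *_) (fromℕ-* (2 ℕ.^ e) 4)) (trans (sym (*-assoc v t (fromℕ 4)))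
      (trans (cong (_* fromℕ 4) (½^n*2^n≡1 e)) (*-identityˡ (fromℕ 4))))) (*-monoʳ-≤′ v 0≤v z≤4t)
  where
  t = fromℕ (2 ℕ.^ e)
  v = (+ 1 / 2) ^ e
  0≤v : 0ℚ ≤ v
  0≤v = <⇒≤ (0<^ e (positive⁻¹ ½))

-- The last `e` with `2^e + ½ ≤ r` has `r < 2^(e+1) + ½`. The margins absorb the distance from `z`
-- to `r`, so comparisons with the single rational `r` settle every `z`; the upper bound uses
-- `2^(e+1) + 1 ≤ 4 * 2^e`.
dyadic-bracket : ∀ s r → fromℕ (2 ℕ.^ s) + ½ ≤ r →
  ∃[ e ] (s ℕ.≤ e × ∀ z → ∣ z - r ∣ < ½ → fromℕ (2 ℕ.^ e) ≤ z × z ≤ fromℕ (2 ℕ.^ e ℕ.* 4))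
dyadic-bracket s r start = e , proj₁ (proj₂ L) , λ z z≈r → t≤z z z≈r , z≤4t z z≈r
  where
  d = proj₁ (archimedean r)
  stop : ¬ fromℕ (2 ℕ.^ (d ℕ.+ s)) + ½ ≤ r
  stop le = <-irrefl {r} refl (<-≤-trans (<-trans
    (<-≤-trans (proj₂ (archimedean r)) (fromℕ-mono-≤ (ℕₚ.≤-trans (ℕₚ.m≤m+n d s) (ℕₚ.<⇒≤ (n<b^n 2 ℕₚ.≤-refl (d ℕ.+ s))))))
    (p<p+q (fromℕ (2 ℕ.^ (d ℕ.+ s))) (positive⁻¹ ½))) le)
  L = last-before {λ n → fromℕ (2 ℕ.^ n) + ½ ≤ r} (λ n → fromℕ (2 ℕ.^ n) + ½ ≤? r) s d start stop
  e = proj₁ L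
  t = fromℕ (2 ℕ.^ e)
  2t = fromℕ (2 ℕ.^ suc e)
  t≤z : ∀ z → ∣ z - r ∣ < ½ → t ≤ z
  t≤z z z≈r = subst₂ _≤_ (solve 2 (λ t h → (t :+ h) :- h := t) refl t ½)
        (solve 2 (λ z h → (h :+ z) :- h := z) refl z ½)
      (+-monoˡ-≤ (- ½) (≤-trans (proj₁ (proj₂ (proj₂ L)))
        (≤-trans (p≤∣p-q∣+q r z) (+-monoˡ-≤ z (subst (_≤ ½) (∣p-q∣≡∣q-p∣ z r) (<⇒≤ z≈r))))))
    where open ℚS
  ½+2t+½≡2t+1 : ½ + (2t + ½) ≡ fromℕ (2 ℕ.^ suc e ℕ.+ 1)
  ½+2t+½≡2t+1 = trans (trans (+-comm ½ (2t + ½)) (+-assoc 2t ½ ½))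
    (sym (trans (fromℕ-+ (2 ℕ.^ suc e) 1) (cong (λ u → 2t + u) fromℕ-1)))
  2t+1≤4t : 2 ℕ.^ suc e ℕ.+ 1 ℕ.≤ 2 ℕ.^ e ℕ.* 4
  2t+1≤4t = ℕₚ.≤-trans (ℕₚ.+-monoʳ-≤ (2 ℕ.^ suc e) (ℕₚ.≤-trans (ℕₚ.m^n>0 2 e) (ℕₚ.m≤n*m (2 ℕ.^ e) 2)))
    (ℕₚ.≤-reflexive (solve 1 (λ u → con 2 :* u :+ con 2 :* u := u :* con 4) refl (2 ℕ.^ e)))
    where open ℕS
  z≤4t : ∀ z → ∣ z - r ∣ < ½ → z ≤ fromℕ (2 ℕ.^ e ℕ.* 4)
  z≤4t z z≈r = ≤-trans (p≤∣p-q∣+q z r) (≤-trans (<⇒≤ (+-mono-< z≈r (≰⇒> (proj₂ (proj₂ (proj₂ L))))))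
    (≤-trans (≤-reflexive ½+2t+½≡2t+1) (fromℕ-mono-≤ 2t+1≤4t)))

module Dyadic (β : ℝ) (1<β : 1ᴿ <ᴿ β) where

  private
    G = 1<⇒[m+1]/m≤ (proj₁ 1<β) (proj₁ (proj₂ 1<β))
    m = proj₁ G
    instance
      m≢0 : NonZero m
      m≢0 = proj₁ (proj₂ G)
    P = polynomial≤exponential 1 8 m
    e₀ = proj₁ P

  -- Exponential growth gives `z^(2^e) ≥ 8 * 2^e`, so the search for the next exponent can begin at
  -- `suc e`, which makes the exponents increase.
  start : ∀ e → e₀ ℕ.≤ e → ∀ z → 1ℚ + proj₁ 1<β < z → fromℕ (2 ℕ.^ suc e) + ½ ≤ z ^ (2 ℕ.^ e)
  start e e₀≤e z 1+c<z = ≤-trans (+-monoʳ-≤ (fromℕ (2 ℕ.^ suc e)) (≤-trans ½≤1 (≤-reflexive (sym fromℕ-1))))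
    (^-lower-bound m (8 ℕ.* q ℕ.^ 1) q (proj₂ (proj₂ G) z (<⇒≤ 1+c<z))
      (proj₂ P q (ℕₚ.≤-trans e₀≤e (ℕₚ.<⇒≤ (n<b^n 2 ℕₚ.≤-refl e))))
      (subst (_≤ fromℕ (8 ℕ.* q ℕ.^ 1)) (fromℕ-+ (2 ℕ.^ suc e) 1) (fromℕ-mono-≤ 2q+1≤8q)))
    where
    open ℕS
    q = 2 ℕ.^ e
    2q+1≤8q : 2 ℕ.* q ℕ.+ 1 ℕ.≤ 8 ℕ.* q ℕ.^ 1
    2q+1≤8q = ℕₚ.≤-trans (ℕₚ.+-monoʳ-≤ (2 ℕ.* q) (ℕₚ.≤-trans (ℕₚ.m^n>0 2 e) (ℕₚ.m≤n*m q 6)))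
      (ℕₚ.≤-reflexive (solve 1 (λ q → con 2 :* q :+ con 6 :* q := con 8 :* (q :* con 1)) refl q))

  -- Finds an index at which to sample the real power: from there on it varies by less than `½`, and
  -- the sampled value of `β` already exceeds 1 by its margin.
  seq-^-close : ∀ q → ∃[ k₀ ] (1ℚ + proj₁ 1<β < seq β k₀ × ∀ k → k₀ ℕ.≤ k → ∣ seq β k ^ q - seq β k₀ ^ q ∣ < ½)
  seq-^-close q = N ℕ.⊔ N′ , proj₂ (proj₂ (proj₂ 1<β)) (N ℕ.⊔ N′) (ℕₚ.m≤n⊔m N N′)
    , λ k k₀≤k → subst₂ (λ u v → ∣ u - v ∣ < ½) (seq-^ β q k) (seq-^ β q (N ℕ.⊔ N′))
        (proj₂ A k (N ℕ.⊔ N′) (ℕₚ.≤-trans (ℕₚ.m≤m⊔n N N′) k₀≤k) (ℕₚ.m≤m⊔n N N′))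
    where
    A = cauchy (β ^ᴿ q) ½ (positive⁻¹ ½)
    N = proj₁ A
    N′ = proj₁ (proj₂ (proj₂ 1<β))

  step : ∀ e → e₀ ℕ.≤ e → ∃[ e′ ] (e ℕ.< e′ × Eventually λ k →
    1ℚ ≤ (+ 1 / 2) ^ e′ * seq β k ^ (2 ℕ.^ e) × (+ 1 / 2) ^ e′ * seq β k ^ (2 ℕ.^ e) ≤ fromℕ 4)
  step e e₀≤e = proj₁ B , proj₁ (proj₂ B) , proj₁ A , λ k k₀≤k →
    let (lo , hi) = proj₂ (proj₂ B) (seq β k ^ (2 ℕ.^ e)) (proj₂ (proj₂ A) k k₀≤k)
    in between-powers⇒scaled (proj₁ B) lo hi
    where
    A = seq-^-close (2 ℕ.^ e)
    B = dyadic-bracket (suc e) (seq β (proj₁ A) ^ (2 ℕ.^ e)) (start e e₀≤e (seq β (proj₁ A)) (proj₁ (proj₂ A)))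

  -- The bound `e₀ ≤ e` is carried along because every `step` needs it.
  exponent : ℕ → ∃[ e ] e₀ ℕ.≤ e
  exponent zero    = e₀ , ℕₚ.≤-refl
  exponent (suc n) = let (e , e₀≤e) = exponent n ; (e′ , e<e′ , _) = step e e₀≤e in
    e′ , ℕₚ.≤-trans e₀≤e (ℕₚ.<⇒≤ e<e′)

  E : ℕ → ℕ
  E n = proj₁ (exponent n)

  E-< : ∀ n → E n ℕ.< E (suc n)
  E-< n = proj₁ (proj₂ (step (E n) (proj₂ (exponent n))))

  scale : ∀ n → Eventually λ k → 1ℚ ≤ (+ 1 / 2) ^ E (suc n) * seq β k ^ (2 ℕ.^ E n)
    × (+ 1 / 2) ^ E (suc n) * seq β k ^ (2 ℕ.^ E n) ≤ fromℕ 4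
  scale n = proj₂ (proj₂ (step (E n) (proj₂ (exponent n))))

-- Tower exponents for a rational base

-- The initial 0 gives `Q 0 = 1 = tower b 0`, so that `b ^ E n` is `E (suc n)` for every `n` and the
-- calibration is exact.
towerExponent : ℕ → ℕ → ℕ
towerExponent b zero    = 0
towerExponent b (suc n) = tower b n

towerExponent-< : ∀ b → 1 ℕ.< b → ∀ n → towerExponent b n ℕ.< towerExponent b (suc n)
towerExponent-< b 1<b zero    = ℕₚ.≤-refl
towerExponent-< b 1<b (suc n) = n<b^n b 1<b (tower b n)

b^towerExponent : ∀ b n → b ℕ.^ towerExponent b n ≡ tower b n
b^towerExponent b zero    = refl
b^towerExponent b (suc n) = refl

1<b/a⇒a<b : ∀ a b .{{_ : NonZero a}} → 1ᴿ <ᴿ fromℚ (+ b / a) → a ℕ.< b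
1<b/a⇒a<b a b (ε , 0<ε , N , f) = ℕₚ.≰⇒> λ b≤a → <-irrefl {fromℕ b} refl (≤-<-trans (fromℕ-mono-≤ b≤a)
  (subst₂ _<_ (*-identityˡ (fromℕ a)) (/-*-cancel (+ b) a)
    (*-monoˡ-<-pos (fromℕ a) {{positive (0<fromℕ a)}} (<-trans (p<p+q 1ℚ 0<ε) (f N ℕₚ.≤-refl)))))

a/b*b/a≡1 : ∀ a b .{{_ : NonZero a}} .{{_ : NonZero b}} → (+ a / b) * (+ b / a) ≡ 1ℚ
a/b*b/a≡1 a b = ≤-antisym (cancel (≤-reflexive eq)) (cancel (≤-reflexive (sym eq)))
  where
  cancel : ∀ {r s} → r * (fromℕ b * fromℕ a) ≤ s * (fromℕ b * fromℕ a) → r ≤ s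
  cancel = *-cancelʳ-≤′ (fromℕ b * fromℕ a) (0<* (0<fromℕ b) (0<fromℕ a))
  eq : (+ a / b) * (+ b / a) * (fromℕ b * fromℕ a) ≡ 1ℚ * (fromℕ b * fromℕ a)
  eq = trans (solve 4 (λ u v b a → u :* v :* (b :* a) := (u :* b) :* (v :* a)) refl (+ a / b) (+ b / a) (fromℕ b) (fromℕ a))
    (trans (cong₂ _*_ (/-*-cancel (+ a) b) (/-*-cancel (+ b) a))
      (trans (*-comm (fromℕ a) (fromℕ b)) (sym (*-identityˡ (fromℕ b * fromℕ a)))))
    where open ℚS

a/b^n*b/a^n≡1 : ∀ a b .{{_ : NonZero a}} .{{_ : NonZero b}} n → (+ a / b) ^ n * (+ b / a) ^ n ≡ 1ℚ
a/b^n*b/a^n≡1 a b n = trans (sym (^-distrib-* (+ a / b) (+ b / a) n)) (trans (cong (_^ n) (a/b*b/a≡1 a b)) (1^≡1 n))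

-- The series for real and for rational bases

real-base : (β : ℝ) (1<β : 1ᴿ <ᴿ β) → ∃[ f ] ∃[ τ ] (HasSum f τ × Conclusion β τ 1<β)
real-base β 1<β = (λ n → fromℚ ((+ 1 / 2) ^ E (suc n))) , Series.τ 1 2 ℕₚ.≤-refl E E-<
  , Series.hasSum 1 2 ℕₚ.≤-refl E E-< (λ _ _ → refl)
  , Construction.conclusion 1 2 ℕₚ.≤-refl (λ { (_ , d∣1) → ℕᵈ.∣1⇒≡1 d∣1 }) E E-< β 1<β scale
  where open Dyadic β 1<β

seq-1/[b/a]^ : ∀ a b .{{_ : NonZero a}} .{{_ : NonZero b}} (0<β : 0ᴿ <ᴿ fromℚ (+ b / a)) t k →
  seq (1/ fromℚ (+ b / a) ^ t ⟨ 0<β ⟩) k ≡ (+ a / b) ^ t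
seq-1/[b/a]^ a b 0<β t k = trans (seq-1/^ (fromℚ (+ b / a)) t 0<β k) (inv-unique (0<^ t 0<b/a) (a/b^n*b/a^n≡1 a b t))
  where
  0<b/a : 0ℚ < + b / a
  0<b/a = proj₂ (eventually⇒∃ {λ _ → 0ℚ < + b / a} (eventually-0< {fromℚ (+ b / a)} 0<β))

tower-scale : ∀ a b .{{_ : NonZero a}} .{{_ : NonZero b}} n → let z = (+ a / b) ^ tower b n * (+ b / a) ^ (b ℕ.^ towerExponent b n) in
  1ℚ ≤ z × z ≤ fromℕ 4
tower-scale a b n = ≤-reflexive (sym ≡1) , ≤-trans (≤-reflexive ≡1) (1≤fromℕ-suc 3)
  where
  ≡1 : (+ a / b) ^ tower b n * (+ b / a) ^ (b ℕ.^ towerExponent b n) ≡ 1ℚ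
  ≡1 = trans (cong (λ t → (+ a / b) ^ tower b n * (+ b / a) ^ t) (b^towerExponent b n)) (a/b^n*b/a^n≡1 a b (tower b n))

-- Here `w = a / b` is the inverse of `β`, so the tower series has the terms `x n`, and
-- `x n * β^(Q n) = 1`.
rational-base : (a b : ℕ) .{{_ : NonZero a}} .{{_ : NonZero b}} → Coprime b a →
  let β = fromℚ (+ b / a) in (1<β : 1ᴿ <ᴿ β) →
  ∃[ τ ] (HasSum (λ n → 1/ β ^ tower b n ⟨ 1<x⇒0<x {β} 1<β ⟩) τ × Conclusion β τ 1<β)
rational-base a b {{a≢0}} {{b≢0}} b⊥a 1<β = τ
  , hasSum {λ n → 1/ fromℚ (_/_ (+ b) a {{a≢0}}) ^ tower b n ⟨ 1<x⇒0<x {fromℚ (_/_ (+ b) a {{a≢0}})} 1<β ⟩} terms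
  , Construction.conclusion a b {{a≢0}} {{b≢0}} a<b b⊥a (towerExponent b) E-< (fromℚ (_/_ (+ b) a {{a≢0}})) 1<β scale
  where
  a<b : a ℕ.< b
  a<b = 1<b/a⇒a<b a b {{a≢0}} 1<β
  E-< : ∀ n → towerExponent b n ℕ.< towerExponent b (suc n)
  E-< = towerExponent-< b (ℕₚ.≤-<-trans (ℕ.>-nonZero⁻¹ a {{a≢0}}) a<b)
  open Series a b {{a≢0}} {{b≢0}} a<b (towerExponent b) E-<
  terms : ∀ n k → seq (1/ fromℚ (+ b / a) ^ tower b n ⟨ 1<x⇒0<x {fromℚ (+ b / a)} 1<β ⟩) k ≡ x n
  terms n = seq-1/[b/a]^ a b (1<x⇒0<x {fromℚ (+ b / a)} 1<β) (tower b n)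
  scale : Calibrated (fromℚ (_/_ (+ b) a {{a≢0}}))
  scale n = 0 , λ _ _ → tower-scale a b n

theorem4 : ((β : ℝ) (1<β : 1ᴿ <ᴿ β) →
    let 0<β = 1<x⇒0<x {β} 1<β in
    ∃[ f ] ∃[ τ ]
    (HasSum f τ
    × Irrational τ
    × IrrationalityBase τ β
    × ¬ Approximable τ (λ q → 1/ β ^ q ⟨ 0<β ⟩)
    × EventuallyFarFromRationals τ β 0<β))
    ×
    ((a b : ℕ) .{{_ : NonZero a}} .{{_ : NonZero b}} → Coprime b a →
    let β = fromℚ (+ b / a) in
    (1<β : 1ᴿ <ᴿ β) →
    let 0<β = 1<x⇒0<x {β} 1<β in
    ∃[ τ ]
    (HasSum (λ n → 1/ β ^ tower b n ⟨ 0<β ⟩) τ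
    × Irrational τ
    × IrrationalityBase τ β
    × ¬ Approximable τ (λ q → 1/ β ^ q ⟨ 0<β ⟩)
    × EventuallyFarFromRationals τ β 0<β))
theorem4 = real-base , rational-base
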